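{- Let $n\ge 1$. The family $\mathcal C_n$ of all distinct full star-simplices and full top-simplices is a good cover of $K_n$ in the simplicial sense: its members (regarded as subcomplexes of $K_n$) cover $K_n$, each member of $\mathcal C_n$ is contractible, and every nonempty finite intersection of members of $\mathcal C_n$ is contractible.
   Context: A partition of $n$ is a weakly decreasing sequence $\lambda=(\lambda_1\ge\cdots\ge\lambda_\ell>0)$ of positive integers with sum $n$, identified with its Ferrers diagram ($\lambda_i$ left-justified cells in row $i$); set $\lambda_{\ell+1}=0$. The partition graph $G_n$ has as vertices all partitions of $n$; two distinct partitions are adjacent if one is obtained from the other by removing one cell from a row, adding it to another row (possibly a new row of length $0$), and reordering the row lengths into weakly decreasing order. $K_n$ is the clique complex of $G_n$: its simplices are the finite nonempty cliques of $G_n$. A removable corner of $\lambda$ is the last cell of a row whose length is strictly greater than that of the next row; an addable corner is a position where a cell can be added so that the result is again a Ferrers diagram of a partition (row $\ell+1$ allowed). Write $r(\cdot)$ for the row number of a corner. For a removable corner $c$ and an addable corner $a$ of $\lambda$ with $r(c)\ne r(a)$, remove $c$ (decrease $\lambda_{r(c)}$ by $1$), add a cell at $a$ (increase $\lambda_{r(a)}$ by $1$), and reorder row lengths. If the result is a partition of $n$ different from $\lambda$, the transfer is called admissible and the result is denoted $\lambda(c\to a)$. The neighbors of $\lambda$ in $G_n$ are exactly the partitions $\lambda(c\to a)$ for admissible transfers. For a removable corner $c$ of $\lambda$: $A_{\max}(\lambda,c):=\{a:\lambda(c\to a)\text{ is admissible}\}$ and the full star-simplex is $\Sigma^{\mathrm{star}}_{\max}(\lambda,c):=\{\lambda\}\cup\{\lambda(c\to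 a):a\in A_{\max}(\lambda,c)\}$. For an addable corner $a$ of $\lambda$: $C_{\max}(\lambda,a):=\{c:\lambda(c\to a)\text{ is admissible}\}$ and the full top-simplex is $\Sigma^{\mathrm{top}}_{\max}(\lambda,a):=\{\lambda\}\cup\{\lambda(c\to a):c\in C_{\max}(\lambda,a)\}$. These are cliques, i.e. simplices of $K_n$; a simplex is regarded as a subcomplex by including all its faces. $\mathcal C_n$ is the set of all full star- and full top-simplices over all partitions $\lambda$ of $n$ and all their corners, with equal simplices identified. -}

module Defs where

open import Data.Bool using (if_then_else_)
open import Data.Fin using (Fin; zero; suc)
open import Data.List using (List; []; _∷_; length; sum; filter; foldr; applyUpTo)
open import Data.List.Membership.Propositional using (_∈_; _∉_)
open import Data.List.Relation.Binary.Permutation.Propositional using (_↭_)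
open import Data.List.Relation.Binary.Subset.Propositional using (_⊆_)
open import Data.List.Relation.Unary.All using (All)
import Data.List.Relation.Unary.All as All
open import Data.List.Relation.Unary.All.Properties using (anti-mono)
open import Data.List.Relation.Unary.Linked using (Linked)
open import Data.List.Relation.Unary.Unique.Propositional using (Unique)
open import Data.Nat as ℕ using (ℕ; zero; suc; pred; _⊔_)
import Data.Nat.Properties as ℕ
open import Data.Product using (_×_; _,_; ∃; ∃-syntax; proj₁; proj₂)
open import Data.Rational as ℚ using (ℚ; 0ℚ; 1ℚ; ½)
import Data.Rational.Properties as ℚ
import Data.Rational.Solver as ℚSolver
open import Data.Sum using (_⊎_; inj₁; inj₂; [_,_]′)
open import Function.Bundles using (_⇔_)
open import Relation.Binary.PropositionalEquality
  using (_≡_; _≢_; refl; sym; trans; cong; cong₂; subst)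
open import Relation.Nullary.Decidable using (does)

------------------------------------------------------------------------
-- Real numbers: Cauchy sequences of rationals with the usual equality

record ℝ : Set where
  constructor mkℝ
  field
    seq    : ℕ → ℚ
    cauchy : ∀ ε → 0ℚ ℚ.< ε →
             ∃[ N ] (∀ m n → N ℕ.≤ m → N ℕ.≤ n → ℚ.∣ seq m ℚ.- seq n ∣ ℚ.≤ ε)

open ℝ public

infix  4 _≃_ _≤_
infixl 6 _+_ _-_

_≃_ : ℝ → ℝ → Set
x ≃ y = ∀ ε → 0ℚ ℚ.< ε →
        ∃[ N ] (∀ n → N ℕ.≤ n → ℚ.∣ seq x n ℚ.- seq y n ∣ ℚ.≤ ε)

_≤_ : ℝ → ℝ → Set
x ≤ y = ∀ ε → 0ℚ ℚ.< ε →
        ∃[ N ] (∀ n → N ℕ.≤ n → seq x n ℚ.≤ seq y n ℚ.+ ε)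

private
  half-pos : ∀ {ε} → 0ℚ ℚ.< ε → 0ℚ ℚ.< ε ℚ.* ½
  half-pos {ε} p = subst (ℚ._< ε ℚ.* ½) (ℚ.*-zeroˡ ½) (ℚ.*-monoˡ-<-pos ½ p)

  halves : ∀ ε → ε ℚ.* ½ ℚ.+ ε ℚ.* ½ ≡ ε
  halves ε = trans (sym (ℚ.*-distribˡ-+ ε ½ ½)) (ℚ.*-identityʳ ε)

  open ℚSolver.+-*-Solver

  interchange : ∀ a b c d →
    (a ℚ.+ b) ℚ.- (c ℚ.+ d) ≡ (a ℚ.- c) ℚ.+ (b ℚ.- d)
  interchange = solve 4 (λ a b c d →
    (a :+ b) :- (c :+ d) := (a :- c) :+ (b :- d)) refl

  neg-diff : ∀ a b → ℚ.- a ℚ.- ℚ.- b ≡ ℚ.- (a ℚ.- b)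
  neg-diff = solve 2 (λ a b → :- a :- :- b := :- (a :- b)) refl

  flip-diff : ∀ a b → ℚ.- (a ℚ.- b) ≡ b ℚ.- a
  flip-diff = solve 2 (λ a b → :- (a :- b) := b :- a) refl

  cancel : ∀ a b → (a ℚ.- b) ℚ.+ b ≡ a
  cancel = solve 2 (λ a b → (a :- b) :+ b := a) refl

  cancel′ : ∀ a b → (a ℚ.+ b) ℚ.- b ≡ a
  cancel′ = solve 2 (λ a b → (a :+ b) :- b := a) refl

  reverse-triangle : ∀ a b → ℚ.∣ ℚ.∣ a ∣ ℚ.- ℚ.∣ b ∣ ∣ ℚ.≤ ℚ.∣ a ℚ.- b ∣
  reverse-triangle a b =
    [ (λ e → subst (ℚ._≤ ℚ.∣ a ℚ.- b ∣) (sym e) (half a b))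
    , (λ e → subst (ℚ._≤ ℚ.∣ a ℚ.- b ∣)
               (sym (trans e (flip-diff ℚ.∣ a ∣ ℚ.∣ b ∣)))
               (subst (ℚ.∣ b ∣ ℚ.- ℚ.∣ a ∣ ℚ.≤_)
                 (trans (sym (cong ℚ.∣_∣ (flip-diff a b))) (ℚ.∣-p∣≡∣p∣ (a ℚ.- b)))
                 (half b a)))
    ]′ (ℚ.∣p∣≡p∨∣p∣≡-p (ℚ.∣ a ∣ ℚ.- ℚ.∣ b ∣))
    where
    half : ∀ a b → ℚ.∣ a ∣ ℚ.- ℚ.∣ b ∣ ℚ.≤ ℚ.∣ a ℚ.- b ∣
    half a b = subst (ℚ.∣ a ∣ ℚ.- ℚ.∣ b ∣ ℚ.≤_) (cancel′ ℚ.∣ a ℚ.- b ∣ ℚ.∣ b ∣)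
      (ℚ.+-monoˡ-≤ (ℚ.- ℚ.∣ b ∣)
        (subst (λ z → ℚ.∣ z ∣ ℚ.≤ ℚ.∣ a ℚ.- b ∣ ℚ.+ ℚ.∣ b ∣) (cancel a b)
          (ℚ.∣p+q∣≤∣p∣+∣q∣ (a ℚ.- b) b)))

fromℚ : ℚ → ℝ
fromℚ q .seq _ = q
fromℚ q .cauchy ε 0<ε =
  0 , λ _ _ _ _ → subst (λ z → ℚ.∣ z ∣ ℚ.≤ ε) (sym (ℚ.+-inverseʳ q)) (ℚ.<⇒≤ 0<ε)

0ℝ 1ℝ : ℝ
0ℝ = fromℚ 0ℚ
1ℝ = fromℚ 1ℚ

_+_ : ℝ → ℝ → ℝ
(x + y) .seq n = seq x n ℚ.+ seq y n
(x + y) .cauchy ε 0<ε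
  with cauchy x (ε ℚ.* ½) (half-pos 0<ε) | cauchy y (ε ℚ.* ½) (half-pos 0<ε)
... | M , p | N , q = M ⊔ N , λ m n m≥ n≥ →
  subst (λ z → ℚ.∣ z ∣ ℚ.≤ ε) (sym (interchange (seq x m) (seq y m) (seq x n) (seq y n)))
    (ℚ.≤-trans (ℚ.∣p+q∣≤∣p∣+∣q∣ (seq x m ℚ.- seq x n) (seq y m ℚ.- seq y n))
      (subst (_ ℚ.≤_) (halves ε)
        (ℚ.+-mono-≤
          (p m n (ℕ.≤-trans (ℕ.m≤m⊔n M N) m≥) (ℕ.≤-trans (ℕ.m≤m⊔n M N) n≥))
          (q m n (ℕ.≤-trans (ℕ.m≤n⊔m M N) m≥) (ℕ.≤-trans (ℕ.m≤n⊔m M N) n≥)))))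

-_ : ℝ → ℝ
(- x) .seq n = ℚ.- seq x n
(- x) .cauchy ε 0<ε with cauchy x ε 0<ε
... | N , p = N , λ m n m≥ n≥ →
  subst (ℚ._≤ ε)
    (sym (trans (cong ℚ.∣_∣ (neg-diff (seq x m) (seq x n)))
                (ℚ.∣-p∣≡∣p∣ (seq x m ℚ.- seq x n))))
    (p m n m≥ n≥)

_-_ : ℝ → ℝ → ℝ
x - y = x + (- y)

∣_∣ : ℝ → ℝ
∣ x ∣ .seq n = ℚ.∣ seq x n ∣
∣ x ∣ .cauchy ε 0<ε with cauchy x ε 0<ε
... | N , p = N , λ m n m≥ n≥ →
  ℚ.≤-trans (reverse-triangle (seq x m) (seq x n)) (p m n m≥ n≥)

record Interval : Set where
  constructor mkInterval
  field
    value : ℝ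
    0≤    : 0ℝ ≤ value
    ≤1    : value ≤ 1ℝ

open Interval public

private
  0≤1ℚ : 0ℚ ℚ.≤ 1ℚ
  0≤1ℚ = ℚ.nonNegative⁻¹ 1ℚ

  fromℚ-mono : ∀ {p q} → p ℚ.≤ q → fromℚ p ≤ fromℚ q
  fromℚ-mono {p} {q} p≤q ε 0<ε = 0 , λ _ _ →
    ℚ.≤-trans p≤q (subst (ℚ._≤ q ℚ.+ ε) (ℚ.+-identityʳ q) (ℚ.+-monoʳ-≤ q (ℚ.<⇒≤ 0<ε)))

𝟎 𝟏 : Interval
𝟎 = mkInterval 0ℝ (fromℚ-mono ℚ.≤-refl) (fromℚ-mono 0≤1ℚ)
𝟏 = mkInterval 1ℝ (fromℚ-mono 0≤1ℚ) (fromℚ-mono ℚ.≤-refl)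

------------------------------------------------------------------------
-- Simplicial complexes

-- A finite set of vertices is given by any list of its elements; `down`
-- makes Simplex insensitive to order and repetitions.  The vertices of the
-- complex are those v : V with Simplex (v ∷ []).
record Complex (V : Set) : Set₁ where
  field
    Simplex  : List V → Set
    nonempty : ∀ {σ} → Simplex σ → σ ≢ []
    down     : ∀ {σ τ} → Simplex σ → τ ≢ [] → τ ⊆ σ → Simplex τ

open Complex public

module _ {V : Set} where

  infix 4 _⊑_ _≐_

  _⊑_ : Complex V → Complex V → Set
  X ⊑ Y = ∀ σ → Simplex X σ → Simplex Y σ

  _≐_ : Complex V → Complex V → Set
  X ≐ Y = ∀ σ → Simplex X σ ⇔ Simplex Y σ

  ⋂ : ∀ {k} → (Fin (suc k) → Complex V) → Complex V
  ⋂ X .Simplex σ    = ∀ i → Simplex (X i) σ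
  ⋂ X .nonempty s   = nonempty (X zero) (s zero)
  ⋂ X .down s ne τ⊆ = λ i → down (X i) (s i) ne τ⊆

  fullSimplex : (V → Set) → Complex V
  fullSimplex S .Simplex σ = σ ≢ [] × All S σ
  fullSimplex S .nonempty  = proj₁
  fullSimplex S .down (_ , all) ne τ⊆ = ne , anti-mono τ⊆ all

  cliqueComplex : (V → V → Set) → Complex V
  cliqueComplex _~_ .Simplex σ =
    σ ≢ [] × (∀ u v → u ∈ σ → v ∈ σ → u ≢ v → u ~ v)
  cliqueComplex _~_ .nonempty = proj₁
  cliqueComplex _~_ .down (_ , c) ne τ⊆ =
    ne , λ u v u∈ v∈ → c u v (τ⊆ u∈) (τ⊆ v∈)

  ∑ : List V → (V → ℝ) → ℝ
  ∑ σ x = foldr (λ v s → x v + s) 0ℝ σ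

  -- Points of the geometric realization in barycentric coordinates.
  record Point (X : Complex V) : Set where
    field
      coord     : V → ℝ
      coord≥0   : ∀ v → 0ℝ ≤ coord v
      supported : ∃[ σ ] Simplex X σ × Unique σ ×
                    (∀ v → v ∉ σ → coord v ≃ 0ℝ) × ∑ σ coord ≃ 1ℝ

  open Point public

  infix 4 _≈_

  _≈_ : {X : Complex V} → Point X → Point X → Set
  x ≈ y = ∀ v → coord x v ≃ coord y v

  -- Sup distance of coordinates; on a finite complex this metric induces
  -- the topology of the geometric realization.
  dist≤ : {X : Complex V} → Point X → Point X → ℚ → Set
  dist≤ x y ε = ∀ v → ∣ coord x v - coord y v ∣ ≤ fromℚ ε

  -- ε-δ continuity at every point of |X| × [0,1].  In particular a
  -- continuous H sends equal points (in the sense of _≈_) to equal points.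
  Continuous : {X : Complex V} → (Point X → Interval → Point X) → Set
  Continuous H = ∀ x t ε → 0ℚ ℚ.< ε → ∃[ δ ] 0ℚ ℚ.< δ ×
    (∀ y s → dist≤ x y δ → ∣ value t - value s ∣ ≤ fromℚ δ →
       dist≤ (H x t) (H y s) ε)

  -- Contractibility of the geometric realization of a finite complex.
  record Contractible (X : Complex V) : Set where
    field
      base       : Point X
      homotopy   : Point X → Interval → Point X
      continuous : Continuous homotopy
      at-0       : ∀ x → homotopy x 𝟎 ≈ x
      at-1       : ∀ x → homotopy x 𝟏 ≈ base

  record GoodCover (K : Complex V) (𝒰 : Complex V → Set) : Set₁ where
    field
      subcomplex    : ∀ U → 𝒰 U → U ⊑ K
      covers        : ∀ σ → Simplex K σ → ∃[ U ] 𝒰 U × Simplex U σ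
      contractible  : ∀ U → 𝒰 U → Contractible U
      intersections : ∀ k (U : Fin (suc k) → Complex V) → (∀ i → 𝒰 (U i)) →
                      ∃[ σ ] Simplex (⋂ U) σ → Contractible (⋂ U)

------------------------------------------------------------------------
-- Partitions and the partition graph

record Partition (n : ℕ) : Set where
  constructor mkPartition
  field
    parts      : List ℕ
    decreasing : Linked ℕ._≥_ parts
    positive   : All (0 ℕ.<_) parts
    total      : sum parts ≡ n

open Partition public

nth : List ℕ → ℕ → ℕ
nth []       _       = 0
nth (x ∷ _)  zero    = x
nth (_ ∷ xs) (suc i) = nth xs i

update : ℕ → (ℕ → ℕ) → (ℕ → ℕ) → (ℕ → ℕ)
update i f r k = if does (k ℕ.≟ i) then f (r k) else r k

module _ {n : ℕ} where

  ℓ : Partition n → ℕ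
  ℓ λ′ = length (parts λ′)

  -- Rows are numbered from 0, so that row ℓ is the first empty row.
  row : Partition n → ℕ → ℕ
  row λ′ = nth (parts λ′)

  -- μ is obtained from λ′ by removing a cell from row i, adding one to row j
  -- (with i, j ≤ ℓ), and reordering; rows that become empty are discarded.
  Transfer : Partition n → ℕ → ℕ → Partition n → Set
  Transfer λ′ i j μ =
    filter (0 ℕ.<?_)
      (applyUpTo (update j suc (update i pred (row λ′))) (suc (ℓ λ′)))
    ↭ parts μ

  Move : Partition n → Partition n → Set
  Move λ′ μ = ∃[ i ] ∃[ j ]
    0 ℕ.< row λ′ i × j ℕ.≤ ℓ λ′ × i ≢ j × Transfer λ′ i j μ

  Adjacent : Partition n → Partition n → Set
  Adjacent λ′ μ = λ′ ≢ μ × (Move λ′ μ ⊎ Move μ λ′)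

  -- A corner is given by its row number.
  Removable : Partition n → ℕ → Set
  Removable λ′ c = row λ′ (suc c) ℕ.< row λ′ c

  -- Adding a cell in row a again gives weakly decreasing row lengths; since
  -- rows from ℓ on are empty, this forces a ≤ ℓ.
  Addable : Partition n → ℕ → Set
  Addable λ′ a = ∀ i → update a suc (row λ′) (suc i) ℕ.≤ update a suc (row λ′) i

  -- The transfer c → a is admissible with result μ = λ′(c → a).
  Admissible : Partition n → ℕ → ℕ → Partition n → Set
  Admissible λ′ c a μ = c ≢ a × Transfer λ′ c a μ × μ ≢ λ′

  StarVertex : Partition n → ℕ → Partition n → Set
  StarVertex λ′ c μ = μ ≡ λ′ ⊎ (∃[ a ] Addable λ′ a × Admissible λ′ c a μ)

  TopVertex : Partition n → ℕ → Partition n → Set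
  TopVertex λ′ a μ = μ ≡ λ′ ⊎ (∃[ c ] Removable λ′ c × Admissible λ′ c a μ)

K : (n : ℕ) → Complex (Partition n)
K n = cliqueComplex Adjacent

-- Membership is up to equality of subcomplexes, so equal simplices arising
-- from different corners are the same member.
data 𝒞 (n : ℕ) (U : Complex (Partition n)) : Set where
  star : ∀ λ′ c → Removable λ′ c → U ≐ fullSimplex (StarVertex λ′ c) → 𝒞 n U
  top  : ∀ λ′ a → Addable   λ′ a → U ≐ fullSimplex (TopVertex  λ′ a) → 𝒞 n U

{-# OPTIONS --safe #-}
module Submission where

-- An intersection of full simplices is again a full simplex, so it contracts
-- linearly to any of its vertices; this gives contractibility.  For the
-- covering property, describe a partition by its column lengths: these do not
-- change when rows are reordered, and an admissible transfer becomes a shift of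
-- one cell from column p to column q ≠ p, with p and q determined by the
-- removed and the added corner.  The results of two shifts (p , q) and (p′ , q′)
-- of the same partition differ by a shift only if p = p′ or q = q′.  Hence
-- in a clique, seen from one of its vertices, either all shifts have the same
-- source (a star-simplex) or all have the same target (a top-simplex).

open import Defs
open import Data.Bool using (if_then_else_)
open import Data.Empty using (⊥; ⊥-elim)
open import Data.Fin using (Fin)
open import Data.List using (List; []; _∷_; length; filter; applyUpTo)
open import Data.List.Membership.Propositional using (_∈_; _∉_; find)
import Data.List.Membership.DecPropositional as DecMembership
open import Data.List.Membership.Propositional.Properties using (∈-∃++)
open import Data.List.Properties using (≡-dec)
open import Data.List.Relation.Binary.Permutation.Propositional as Perm
  using (_↭_; prep; swap; ↭-sym)
open import Data.List.Relation.Binary.Permutation.Propositional.Properties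
  using (shift; All-resp-↭)
open import Data.List.Relation.Unary.All as All using (All; []; _∷_)
open import Data.List.Relation.Unary.All.Properties using (all-filter; ¬Any⇒All¬; All¬⇒¬Any)
open import Data.List.Relation.Unary.AllPairs using ([]; _∷_)
open import Data.List.Relation.Unary.Any using (Any; here; there)
open import Data.List.Relation.Unary.Linked as Linked using (Linked; []; [-]; _∷_)
open import Data.List.Relation.Unary.Unique.Propositional using (Unique)
open import Data.Nat as ℕ using (ℕ; zero; suc; pred; z≤n; s≤s; _≥_)
import Data.Nat.Properties as ℕ
open import Data.Nat.Solver using (module +-*-Solver)
open import Data.Product using (_×_; _,_; ∃-syntax; proj₁; proj₂)
open import Data.Rational as ℚ using (ℚ; 0ℚ; 1ℚ; ½)
import Data.Rational.Properties as ℚ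
import Data.Rational.Solver as ℚSolver
open import Data.Sum as Sum using (_⊎_; inj₁; inj₂; [_,_]′)
open import Function using (_∘_; id)
open import Function.Bundles using (Equivalence; mk⇔)
open import Relation.Binary.Definitions using (DecidableEquality)
open import Relation.Binary.PropositionalEquality
  using (_≡_; _≢_; refl; sym; trans; cong; cong₂; subst; subst₂; module ≡-Reasoning)
open import Relation.Nullary.Decidable using (yes; no; does; map′; toSum)

half-pos : ∀ {ε} → 0ℚ ℚ.< ε → 0ℚ ℚ.< ε ℚ.* ½
half-pos {ε} p = subst (ℚ._< ε ℚ.* ½) (ℚ.*-zeroˡ ½) (ℚ.*-monoˡ-<-pos ½ p)

halves : ∀ ε → ε ℚ.* ½ ℚ.+ ε ℚ.* ½ ≡ ε
halves ε = trans (sym (ℚ.*-distribˡ-+ ε ½ ½)) (ℚ.*-identityʳ ε)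

-- Rational inequalities

p≤p+q : ∀ p {q} → 0ℚ ℚ.≤ q → p ℚ.≤ p ℚ.+ q
p≤p+q p 0≤q = subst (ℚ._≤ p ℚ.+ _) (ℚ.+-identityʳ p) (ℚ.+-monoʳ-≤ p 0≤q)

p≤q+p : ∀ p {q} → 0ℚ ℚ.≤ q → p ℚ.≤ q ℚ.+ p
p≤q+p p {q} 0≤q = subst (p ℚ.≤_) (ℚ.+-comm p q) (p≤p+q p 0≤q)

p≤∣p∣ : ∀ p → p ℚ.≤ ℚ.∣ p ∣
p≤∣p∣ p with ℚ.≤-total 0ℚ p
... | inj₁ 0≤p = ℚ.≤-reflexive (sym (ℚ.0≤p⇒∣p∣≡p 0≤p))
... | inj₂ p≤0 = ℚ.≤-trans p≤0 (ℚ.0≤∣p∣ p)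

flip-diff : ∀ p q → ℚ.- (p ℚ.- q) ≡ q ℚ.- p
flip-diff = solve 2 (λ p q → :- (p :- q) := q :- p) refl
  where open ℚSolver.+-*-Solver

∣p-q∣≡∣q-p∣ : ∀ p q → ℚ.∣ p ℚ.- q ∣ ≡ ℚ.∣ q ℚ.- p ∣
∣p-q∣≡∣q-p∣ p q = trans (sym (ℚ.∣-p∣≡∣p∣ (p ℚ.- q))) (cong ℚ.∣_∣ (flip-diff p q))

p-q≤r : ∀ p q r → p ℚ.≤ q ℚ.+ r → p ℚ.- q ℚ.≤ r
p-q≤r p q r p≤ = subst (p ℚ.- q ℚ.≤_) (cancel q r) (ℚ.+-monoˡ-≤ (ℚ.- q) p≤)
  where
  open ℚSolver.+-*-Solver
  cancel : ∀ a b → (a ℚ.+ b) ℚ.- a ≡ b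
  cancel = solve 2 (λ a b → (a :+ b) :- a := b) refl

p≤q+∣p-q∣ : ∀ p q → p ℚ.≤ q ℚ.+ ℚ.∣ p ℚ.- q ∣
p≤q+∣p-q∣ p q =
  subst (ℚ._≤ q ℚ.+ ℚ.∣ p ℚ.- q ∣) (cancel p q) (ℚ.+-monoʳ-≤ q (p≤∣p∣ (p ℚ.- q)))
  where
  open ℚSolver.+-*-Solver
  cancel : ∀ a b → b ℚ.+ (a ℚ.- b) ≡ a
  cancel = solve 2 (λ a b → b :+ (a :- b) := a) refl

∣p-q∣≤r : ∀ {p q r} → p ℚ.≤ q ℚ.+ r → q ℚ.≤ p ℚ.+ r → ℚ.∣ p ℚ.- q ∣ ℚ.≤ r
∣p-q∣≤r {p} {q} {r} p≤ q≤ with ℚ.∣p∣≡p∨∣p∣≡-p (p ℚ.- q)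
... | inj₁ e = subst (ℚ._≤ r) (sym e) (p-q≤r p q r p≤)
... | inj₂ e = subst (ℚ._≤ r) (sym (trans e (flip-diff p q))) (p-q≤r q p r q≤)

∣p-r∣≤∣p-q∣+∣q-r∣ : ∀ p q r → ℚ.∣ p ℚ.- r ∣ ℚ.≤ ℚ.∣ p ℚ.- q ∣ ℚ.+ ℚ.∣ q ℚ.- r ∣
∣p-r∣≤∣p-q∣+∣q-r∣ p q r =
  subst (λ z → ℚ.∣ z ∣ ℚ.≤ ℚ.∣ p ℚ.- q ∣ ℚ.+ ℚ.∣ q ℚ.- r ∣)
    (telescope p q r) (ℚ.∣p+q∣≤∣p∣+∣q∣ (p ℚ.- q) (q ℚ.- r))
  where
  open ℚSolver.+-*-Solver
  telescope : ∀ a b c → (a ℚ.- b) ℚ.+ (b ℚ.- c) ≡ a ℚ.- c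
  telescope = solve 3 (λ a b c → (a :- b) :+ (b :- c) := a :- c) refl

-- Clamping to the unit interval and linear interpolation.

InUnit : ℚ → Set
InUnit q = 0ℚ ℚ.≤ q × q ℚ.≤ 1ℚ

0≤1ℚ : 0ℚ ℚ.≤ 1ℚ
0≤1ℚ = ℚ.nonNegative⁻¹ 1ℚ

inUnit-dist : ∀ {p q} → InUnit p → InUnit q → ℚ.∣ p ℚ.- q ∣ ℚ.≤ 1ℚ
inUnit-dist (0≤p , p≤1) (0≤q , q≤1) =
  ∣p-q∣≤r (ℚ.≤-trans p≤1 (p≤q+p 1ℚ 0≤q)) (ℚ.≤-trans q≤1 (p≤q+p 1ℚ 0≤p))

*-contract : ∀ p q → ℚ.∣ p ∣ ℚ.≤ 1ℚ → ℚ.∣ p ℚ.* q ∣ ℚ.≤ ℚ.∣ q ∣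
*-contract p q p≤1 = subst₂ ℚ._≤_ (sym (ℚ.∣p*q∣≡∣p∣*∣q∣ p q)) (ℚ.*-identityˡ ℚ.∣ q ∣)
  (ℚ.*-monoʳ-≤-nonNeg ℚ.∣ q ∣ {{ℚ.nonNegative (ℚ.0≤∣p∣ q)}} p≤1)

0≤p*q : ∀ {p q} → 0ℚ ℚ.≤ p → 0ℚ ℚ.≤ q → 0ℚ ℚ.≤ p ℚ.* q
0≤p*q {p} {q} 0≤p 0≤q = subst (ℚ._≤ p ℚ.* q) (ℚ.*-zeroˡ q)
  (ℚ.*-monoʳ-≤-nonNeg q {{ℚ.nonNegative 0≤q}} 0≤p)

clamp : ℚ → ℚ
clamp q = 0ℚ ℚ.⊔ (q ℚ.⊓ 1ℚ)

clamp-inUnit : ∀ q → InUnit (clamp q)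
clamp-inUnit q = ℚ.p≤p⊔q 0ℚ (q ℚ.⊓ 1ℚ) , ℚ.⊔-lub 0≤1ℚ (ℚ.p⊓q≤q q 1ℚ)

-- A one-sided form of the Lipschitz bound: both inequalities needed by `∣p-q∣≤r` are instances of
-- it, with `p` and `q` exchanged.
clamp-≤ : ∀ {p q r} → 0ℚ ℚ.≤ r → p ℚ.≤ q ℚ.+ r → clamp p ℚ.≤ clamp q ℚ.+ r
clamp-≤ {p} {q} {r} 0≤r p≤ = ℚ.⊔-lub
  (ℚ.≤-trans (proj₁ (clamp-inUnit q)) (p≤p+q (clamp q) 0≤r))
  (ℚ.≤-trans min≤ (ℚ.+-monoˡ-≤ r (ℚ.p≤q⊔p 0ℚ (q ℚ.⊓ 1ℚ))))
  where
  min≤ : p ℚ.⊓ 1ℚ ℚ.≤ (q ℚ.⊓ 1ℚ) ℚ.+ r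
  min≤ with ℚ.⊓-sel q 1ℚ
  ... | inj₁ e rewrite e = ℚ.≤-trans (ℚ.p⊓q≤p p 1ℚ) p≤
  ... | inj₂ e rewrite e = ℚ.≤-trans (ℚ.p⊓q≤q p 1ℚ) (p≤p+q 1ℚ 0≤r)

clamp-lipschitz : ∀ p q → ℚ.∣ clamp p ℚ.- clamp q ∣ ℚ.≤ ℚ.∣ p ℚ.- q ∣
clamp-lipschitz p q = ∣p-q∣≤r
  (clamp-≤ {p} {q} (ℚ.0≤∣p∣ (p ℚ.- q)) (p≤q+∣p-q∣ p q))
  (clamp-≤ {q} {p} (ℚ.0≤∣p∣ (p ℚ.- q))
    (subst (λ z → q ℚ.≤ p ℚ.+ z) (∣p-q∣≡∣q-p∣ q p) (p≤q+∣p-q∣ q p)))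

-- The approximants of a real in [0,1] satisfy the two bounds only up to `ε`; clamping them
-- therefore changes them by at most `ε`.
clamp-near : ∀ {q ε} → 0ℚ ℚ.≤ ε → 0ℚ ℚ.≤ q ℚ.+ ε → q ℚ.≤ 1ℚ ℚ.+ ε →
             ℚ.∣ clamp q ℚ.- q ∣ ℚ.≤ ε
clamp-near {q} {ε} 0≤ε lo hi = ∣p-q∣≤r
  (ℚ.⊔-lub lo (ℚ.≤-trans (ℚ.p⊓q≤p q 1ℚ) (p≤p+q q 0≤ε)))
  (ℚ.≤-trans q≤ (ℚ.+-monoˡ-≤ ε (ℚ.p≤q⊔p 0ℚ (q ℚ.⊓ 1ℚ))))
  where
  q≤ : q ℚ.≤ (q ℚ.⊓ 1ℚ) ℚ.+ ε
  q≤ with ℚ.⊓-sel q 1ℚ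
  ... | inj₁ e = subst (λ z → q ℚ.≤ z ℚ.+ ε) (sym e) (p≤p+q q 0≤ε)
  ... | inj₂ e = subst (λ z → q ℚ.≤ z ℚ.+ ε) (sym e) hi

lerp : ℚ → ℚ → ℚ → ℚ
lerp t p q = p ℚ.+ t ℚ.* (q ℚ.- p)

lerp-0 : ∀ p q → lerp 0ℚ p q ≡ p
lerp-0 p q = trans (cong (p ℚ.+_) (ℚ.*-zeroˡ (q ℚ.- p))) (ℚ.+-identityʳ p)

lerp-1 : ∀ p q → lerp 1ℚ p q ≡ q
lerp-1 = solve 2 (λ p q → p :+ con 1ℚ :* (q :- p) := q) refl
  where open ℚSolver.+-*-Solver

lerp-self : ∀ t p → lerp t p p ≡ p
lerp-self = solve 2 (λ t p → p :+ t :* (p :- p) := p) refl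
  where open ℚSolver.+-*-Solver

lerp-+ : ∀ t p q r s {u v} → p ℚ.+ r ≡ u → q ℚ.+ s ≡ v →
         lerp t p q ℚ.+ lerp t r s ≡ lerp t u v
lerp-+ t p q r s refl refl = solve 5 (λ t p q r s →
    (p :+ t :* (q :- p)) :+ (r :+ t :* (s :- r)) :=
    (p :+ r) :+ t :* ((q :+ s) :- (p :+ r))) refl t p q r s
  where open ℚSolver.+-*-Solver

lerp-nonneg : ∀ {t p q} → InUnit t → 0ℚ ℚ.≤ p → 0ℚ ℚ.≤ q → 0ℚ ℚ.≤ lerp t p q
lerp-nonneg {t} {p} {q} (0≤t , t≤1) 0≤p 0≤q = subst (0ℚ ℚ.≤_) (convex t p q)
  (ℚ.+-mono-≤ (0≤p*q 0≤1-t 0≤p) (0≤p*q 0≤t 0≤q))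
  where
  open ℚSolver.+-*-Solver
  convex : ∀ t p q → (1ℚ ℚ.- t) ℚ.* p ℚ.+ t ℚ.* q ≡ lerp t p q
  convex = solve 3 (λ t p q →
    (con 1ℚ :- t) :* p :+ t :* q := p :+ t :* (q :- p)) refl
  0≤1-t : 0ℚ ℚ.≤ 1ℚ ℚ.- t
  0≤1-t = subst (ℚ._≤ 1ℚ ℚ.- t) (ℚ.+-inverseʳ t) (ℚ.+-monoˡ-≤ (ℚ.- t) t≤1)

-- The error is (1 - t)(p - q), whose first factor is at most 1 in absolute value. Hence
-- interpolation towards `q` preserves being equal to `q` as a real, whatever the parameter does
-- along the sequence.
lerp-near : ∀ {t} p q {r} → InUnit t → r ≡ lerp t p q →
            ℚ.∣ r ℚ.- q ∣ ℚ.≤ ℚ.∣ p ℚ.- q ∣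
lerp-near {t} p q t∈ refl = subst (λ z → ℚ.∣ z ∣ ℚ.≤ ℚ.∣ p ℚ.- q ∣) (factor t p q)
  (*-contract (1ℚ ℚ.- t) (p ℚ.- q) (inUnit-dist (0≤1ℚ , ℚ.≤-refl) t∈))
  where
  open ℚSolver.+-*-Solver
  factor : ∀ t p q → (1ℚ ℚ.- t) ℚ.* (p ℚ.- q) ≡ lerp t p q ℚ.- q
  factor = solve 3 (λ t p q →
    (con 1ℚ :- t) :* (p :- q) := (p :+ t :* (q :- p)) :- q) refl

-- The difference splits as (1 - s)(p - q) + (r - p)(t - s), where the coefficients 1 - s and r - p
-- have absolute value at most 1.
lerp-lipschitz : ∀ {s t p q r} → InUnit s → InUnit p → InUnit r →
  ℚ.∣ lerp t p r ℚ.- lerp s q r ∣ ℚ.≤ ℚ.∣ p ℚ.- q ∣ ℚ.+ ℚ.∣ t ℚ.- s ∣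
lerp-lipschitz {s} {t} {p} {q} {r} s∈ p∈ r∈ =
  subst (λ z → ℚ.∣ z ∣ ℚ.≤ ℚ.∣ p ℚ.- q ∣ ℚ.+ ℚ.∣ t ℚ.- s ∣) (split s t p q r)
    (ℚ.≤-trans
      (ℚ.∣p+q∣≤∣p∣+∣q∣ ((1ℚ ℚ.- s) ℚ.* (p ℚ.- q)) ((r ℚ.- p) ℚ.* (t ℚ.- s)))
      (ℚ.+-mono-≤
        (*-contract (1ℚ ℚ.- s) (p ℚ.- q) (inUnit-dist (0≤1ℚ , ℚ.≤-refl) s∈))
        (*-contract (r ℚ.- p) (t ℚ.- s) (inUnit-dist r∈ p∈))))
  where
  open ℚSolver.+-*-Solver
  split : ∀ s t p q r → (1ℚ ℚ.- s) ℚ.* (p ℚ.- q) ℚ.+ (r ℚ.- p) ℚ.* (t ℚ.- s)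
          ≡ lerp t p r ℚ.- lerp s q r
  split = solve 5 (λ s t p q r →
    (con 1ℚ :- s) :* (p :- q) :+ (r :- p) :* (t :- s) :=
    (p :+ t :* (r :- p)) :- (q :+ s :* (r :- q))) refl

-- Real numbers

Eventually : (ℕ → Set) → Set
Eventually P = ∃[ N ] (∀ n → N ℕ.≤ n → P n)

always : ∀ {P : ℕ → Set} → (∀ n → P n) → Eventually P
always p = 0 , λ n _ → p n

mapᵉ : ∀ {P Q : ℕ → Set} → (∀ n → P n → Q n) → Eventually P → Eventually Q
mapᵉ f (N , p) = N , λ n n≥ → f n (p n n≥)

zipᵉ : ∀ {P Q R : ℕ → Set} → (∀ n → P n → Q n → R n) →
       Eventually P → Eventually Q → Eventually R
zipᵉ f (M , p) (N , q) = M ℕ.⊔ N , λ n n≥ →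
  f n (p n (ℕ.≤-trans (ℕ.m≤m⊔n M N) n≥)) (q n (ℕ.≤-trans (ℕ.m≤n⊔m M N) n≥))

≡⇒≃ : ∀ {x y} → (∀ n → seq x n ≡ seq y n) → x ≃ y
≡⇒≃ {x} {y} e ε 0<ε = always λ n →
  subst (λ z → ℚ.∣ seq x n ℚ.- z ∣ ℚ.≤ ε) (e n)
    (subst (λ z → ℚ.∣ z ∣ ℚ.≤ ε) (sym (ℚ.+-inverseʳ (seq x n))) (ℚ.<⇒≤ 0<ε))

≃-trans : ∀ {x y z} → x ≃ y → y ≃ z → x ≃ z
≃-trans {x} {y} {z} x≃y y≃z ε 0<ε =
  zipᵉ (λ n p q → ℚ.≤-trans (∣p-r∣≤∣p-q∣+∣q-r∣ (seq x n) (seq y n) (seq z n))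
                   (subst (_ ℚ.≤_) (halves ε) (ℚ.+-mono-≤ p q)))
    (x≃y (ε ℚ.* ½) (half-pos 0<ε)) (y≃z (ε ℚ.* ½) (half-pos 0<ε))

≃-dominated : ∀ {w x y z} →
  (∀ n → ℚ.∣ seq w n ℚ.- seq x n ∣ ℚ.≤ ℚ.∣ seq y n ℚ.- seq z n ∣) → y ≃ z → w ≃ x
≃-dominated dom y≃z ε 0<ε = mapᵉ (λ n → ℚ.≤-trans (dom n)) (y≃z ε 0<ε)

+-cong : ∀ {w x y z} → w ≃ x → y ≃ z → w + y ≃ x + z
+-cong {w} {x} {y} {z} w≃x y≃z ε 0<ε =
  zipᵉ (λ n p q → subst (λ d → ℚ.∣ d ∣ ℚ.≤ ε)
      (interchange (seq w n) (seq x n) (seq y n) (seq z n))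
      (ℚ.≤-trans (ℚ.∣p+q∣≤∣p∣+∣q∣ (seq w n ℚ.- seq x n) (seq y n ℚ.- seq z n))
                   (subst (_ ℚ.≤_) (halves ε) (ℚ.+-mono-≤ p q))))
    (w≃x (ε ℚ.* ½) (half-pos 0<ε)) (y≃z (ε ℚ.* ½) (half-pos 0<ε))
  where
  open ℚSolver.+-*-Solver
  interchange : ∀ a b c d → (a ℚ.- b) ℚ.+ (c ℚ.- d) ≡ (a ℚ.+ c) ℚ.- (b ℚ.+ d)
  interchange = solve 4 (λ a b c d → (a :- b) :+ (c :- d) := (a :+ c) :- (b :+ d)) refl

≃⇒≤ : ∀ {x y} → x ≃ y → x ≤ y
≃⇒≤ {x} {y} x≃y ε 0<ε =
  mapᵉ (λ n p → ℚ.≤-trans (p≤q+∣p-q∣ (seq x n) (seq y n)) (ℚ.+-monoʳ-≤ (seq y n) p))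
    (x≃y ε 0<ε)

≤-trans : ∀ {x y z} → x ≤ y → y ≤ z → x ≤ z
≤-trans {x} {y} {z} x≤y y≤z ε 0<ε =
  zipᵉ (λ n p q → ℚ.≤-trans p (subst (seq y n ℚ.+ ε ℚ.* ½ ℚ.≤_)
      (trans (ℚ.+-assoc (seq z n) (ε ℚ.* ½) (ε ℚ.* ½)) (cong (seq z n ℚ.+_) (halves ε)))
      (ℚ.+-monoˡ-≤ (ε ℚ.* ½) q)))
    (x≤y (ε ℚ.* ½) (half-pos 0<ε)) (y≤z (ε ℚ.* ½) (half-pos 0<ε))

0≤⇒≤+ : ∀ x {y} → 0ℝ ≤ y → x ≤ x + y
0≤⇒≤+ x {y} 0≤y ε 0<ε =
  mapᵉ (λ n p → subst (seq x n ℚ.≤_) (sym (ℚ.+-assoc (seq x n) (seq y n) ε))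
                  (p≤p+q (seq x n) p))
    (0≤y ε 0<ε)

0≤⇒≤+ˡ : ∀ {x} y → 0ℝ ≤ x → y ≤ x + y
0≤⇒≤+ˡ {x} y 0≤x =
  ≤-trans {y} {y + x} {x + y} (0≤⇒≤+ y {x} 0≤x)
    (≃⇒≤ {y + x} {x + y} (≡⇒≃ {y + x} {x + y} λ n → ℚ.+-comm (seq y n) (seq x n)))

clampℝ : ℝ → ℝ
clampℝ x .seq n = clamp (seq x n)
clampℝ x .cauchy ε 0<ε with cauchy x ε 0<ε
... | N , p = N , λ m n m≥ n≥ →
  ℚ.≤-trans (clamp-lipschitz (seq x m) (seq x n)) (p m n m≥ n≥)

clampℝ-≃ : ∀ x → 0ℝ ≤ x → x ≤ 1ℝ → clampℝ x ≃ x
clampℝ-≃ x 0≤x x≤1 ε 0<ε =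
  zipᵉ (λ n → clamp-near (ℚ.<⇒≤ 0<ε)) (0≤x ε 0<ε) (x≤1 ε 0<ε)

lerp-clamp-lipschitz : ∀ {t s p q r} → InUnit r →
  ℚ.∣ lerp (clamp t) (clamp p) r ℚ.- lerp (clamp s) (clamp q) r ∣
    ℚ.≤ ℚ.∣ p ℚ.- q ∣ ℚ.+ ℚ.∣ t ℚ.- s ∣
lerp-clamp-lipschitz {t} {s} {p} {q} r∈ = ℚ.≤-trans
  (lerp-lipschitz {clamp s} {clamp t} {clamp p} {clamp q}
    (clamp-inUnit s) (clamp-inUnit p) r∈)
  (ℚ.+-mono-≤ (clamp-lipschitz p q) (clamp-lipschitz t s))

-- Clamping t and x leaves the represented reals unchanged when these lie in
-- [0,1], and makes the product Lipschitz without a choice of bounds.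
lerpℝ : ℝ → ℝ → (q : ℚ) → InUnit q → ℝ
lerpℝ t x q _ .seq n = lerp (clamp (seq t n)) (clamp (seq x n)) q
lerpℝ t x q q∈ .cauchy ε 0<ε
  with cauchy x (ε ℚ.* ½) (half-pos 0<ε) | cauchy t (ε ℚ.* ½) (half-pos 0<ε)
... | M , p | N , p′ = M ℕ.⊔ N , λ m n m≥ n≥ → ℚ.≤-trans
  (lerp-clamp-lipschitz {seq t m} {seq t n} {seq x m} {seq x n} q∈)
  (subst (_ ℚ.≤_) (halves ε) (ℚ.+-mono-≤
    (p  m n (ℕ.≤-trans (ℕ.m≤m⊔n M N) m≥) (ℕ.≤-trans (ℕ.m≤m⊔n M N) n≥))
    (p′ m n (ℕ.≤-trans (ℕ.m≤n⊔m M N) m≥) (ℕ.≤-trans (ℕ.m≤n⊔m M N) n≥))))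

lerpℝ-0 : ∀ x {q} (q∈ : InUnit q) → 0ℝ ≤ x → x ≤ 1ℝ → lerpℝ 0ℝ x q q∈ ≃ x
lerpℝ-0 x {q} q∈ 0≤x x≤1 = ≃-trans {lerpℝ 0ℝ x q q∈} {clampℝ x} {x}
  (≡⇒≃ {lerpℝ 0ℝ x q q∈} {clampℝ x} λ n → lerp-0 (clamp (seq x n)) q)
  (clampℝ-≃ x 0≤x x≤1)

-- Finite sums of coordinates.

module _ {V : Set} where

  -- Head and tail values are passed through equations, so that the arithmetic takes place on the
  -- rationals `p`, `q`, `r` alone.
  seq-∑-∷ : ∀ {v σ} {f : V → ℝ} {n} p q r → p ℚ.+ q ≡ r →
            seq (f v) n ≡ p → seq (∑ σ f) n ≡ q → seq (∑ (v ∷ σ) f) n ≡ r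
  seq-∑-∷ p q r p+q≡r refl refl = p+q≡r

  seq-∑-lerp : ∀ t n (f g h : V → ℝ) →
    (∀ v → seq (f v) n ≡ lerp t (seq (g v) n) (seq (h v) n)) →
    ∀ σ → seq (∑ σ f) n ≡ lerp t (seq (∑ σ g) n) (seq (∑ σ h) n)
  seq-∑-lerp t n f g h e []      = sym (lerp-self t 0ℚ)
  seq-∑-lerp t n f g h e (v ∷ σ) = seq-∑-∷ {v} {σ} {f} {n} _ _ _
    (lerp-+ t (seq (g v) n) (seq (h v) n) (seq (∑ σ g) n) (seq (∑ σ h) n) refl refl)
    (e v) (seq-∑-lerp t n f g h e σ)

  ∑-cong : ∀ σ {f g : V → ℝ} → (∀ v → f v ≃ g v) → ∑ σ f ≃ ∑ σ g
  ∑-cong []      f≃g = ≡⇒≃ {0ℝ} {0ℝ} λ _ → refl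
  ∑-cong (v ∷ σ) {f} {g} f≃g =
    +-cong {f v} {g v} {∑ σ f} {∑ σ g} (f≃g v) (∑-cong σ {f} {g} f≃g)

  ∑-nonneg : ∀ σ {f : V → ℝ} → (∀ v → 0ℝ ≤ f v) → 0ℝ ≤ ∑ σ f
  ∑-nonneg []      0≤f = ≃⇒≤ {0ℝ} {0ℝ} (≡⇒≃ {0ℝ} {0ℝ} λ _ → refl)
  ∑-nonneg (v ∷ σ) {f} 0≤f = ≤-trans {0ℝ} {f v} {f v + ∑ σ f} (0≤f v)
    (0≤⇒≤+ (f v) {∑ σ f} (∑-nonneg σ {f} 0≤f))

  term≤∑ : ∀ {w σ} {f : V → ℝ} → (∀ v → 0ℝ ≤ f v) → w ∈ σ → f w ≤ ∑ σ f
  term≤∑ {w} {v ∷ σ} {f} 0≤f (here refl) = 0≤⇒≤+ (f v) {∑ σ f} (∑-nonneg σ {f} 0≤f)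
  term≤∑ {w} {v ∷ σ} {f} 0≤f (there w∈) = ≤-trans {f w} {∑ σ f} {f v + ∑ σ f}
    (term≤∑ {f = f} 0≤f w∈) (0≤⇒≤+ˡ {f v} (∑ σ f) (0≤f v))

-- Contracting a cone linearly to its apex

module _ {V : Set} (_≟_ : DecidableEquality V) where

  open DecMembership _≟_ using (_∈?_)

  indicator : V → V → ℚ
  indicator v w = if does (w ≟ v) then 1ℚ else 0ℚ

  indicatorℝ : V → V → ℝ
  indicatorℝ v w = fromℚ (indicator v w)

  indicator-inUnit : ∀ v w → InUnit (indicator v w)
  indicator-inUnit v w with w ≟ v
  ... | yes _ = 0≤1ℚ , ℚ.≤-refl
  ... | no  _ = ℚ.≤-refl , 0≤1ℚ

  indicator-self : ∀ v → indicator v v ≡ 1ℚ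
  indicator-self v with v ≟ v
  ... | yes _  = refl
  ... | no v≢v = ⊥-elim (v≢v refl)

  indicator-other : ∀ {v w} → w ≢ v → indicator v w ≡ 0ℚ
  indicator-other {v} {w} w≢v with w ≟ v
  ... | yes e = ⊥-elim (w≢v e)
  ... | no _  = refl

  ∑-indicator-∉ : ∀ {v} σ → v ∉ σ → ∀ n → seq (∑ σ (indicatorℝ v)) n ≡ 0ℚ
  ∑-indicator-∉ []      v∉ n = refl
  ∑-indicator-∉ {v} (w ∷ σ) v∉ n =
    seq-∑-∷ {σ = σ} {f = indicatorℝ v} 0ℚ 0ℚ 0ℚ refl
      (indicator-other (λ { refl → v∉ (here refl) })) (∑-indicator-∉ σ (λ v∈ → v∉ (there v∈)) n)

  ∑-indicator-∈ : ∀ {v σ} → Unique σ → v ∈ σ → ∀ n →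
                  seq (∑ σ (indicatorℝ v)) n ≡ 1ℚ
  ∑-indicator-∈ {v} {_ ∷ σ} (v≢ ∷ _) (here refl) n =
    seq-∑-∷ {σ = σ} {f = indicatorℝ v} 1ℚ 0ℚ 1ℚ refl
      (indicator-self v) (∑-indicator-∉ σ (All¬⇒¬Any v≢) n)
  ∑-indicator-∈ {v} {w ∷ σ} (w≢ ∷ uniq) (there v∈) n =
    seq-∑-∷ {σ = σ} {f = indicatorℝ v} 0ℚ 1ℚ 1ℚ refl
      (indicator-other (λ { refl → All¬⇒¬Any w≢ v∈ })) (∑-indicator-∈ uniq v∈ n)

  towards : V → ℝ → (V → ℝ) → V → ℝ
  towards v t x w = lerpℝ t (x w) (indicator v w) (indicator-inUnit v w)

  module _ {X : Complex V} where

    -- On the support, a coordinate is one of the nonnegative terms of a sum equal to 1; off the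
    -- support it is 0. This bound is what makes clamping harmless.
    coord≤1 : ∀ (x : Point X) w → coord x w ≤ 1ℝ
    coord≤1 x w with supported x
    ... | σ , _ , _ , outside , total with w ∈? σ
    ...   | yes w∈ = ≤-trans {coord x w} {∑ σ (coord x)} {1ℝ}
                       (term≤∑ {f = coord x} (coord≥0 x) w∈) (≃⇒≤ {∑ σ (coord x)} {1ℝ} total)
    ...   | no  w∉ = ≤-trans {coord x w} {0ℝ} {1ℝ} (≃⇒≤ {coord x w} {0ℝ} (outside w w∉)) (0≤ 𝟏)

    -- Together `apex` and `join` say that `X` is a cone with apex `v`.
    module _ (v : V) (apex : Simplex X (v ∷ []))
             (join : ∀ {σ} → Simplex X σ → Simplex X (v ∷ σ)) where

      vertexPoint : Point X
      vertexPoint .coord w = indicatorℝ v w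
      vertexPoint .coord≥0 w ε 0<ε = always λ _ →
        ℚ.≤-trans (proj₁ (indicator-inUnit v w)) (p≤p+q (indicator v w) (ℚ.<⇒≤ 0<ε))
      vertexPoint .supported =
        v ∷ [] , apex , [] ∷ [] ,
        (λ w w∉ → ≡⇒≃ {indicatorℝ v w} {0ℝ} λ _ → indicator-other (w∉ ∘ here)) ,
        ≡⇒≃ {∑ (v ∷ []) (indicatorℝ v)} {1ℝ}
          (∑-indicator-∈ ([] ∷ []) (here refl))

      -- The contraction puts weight on `v`, so the supporting simplex has to contain `v`; if it
      -- does not, `join` adds it with coordinate 0.
      supportWithApex : (x : Point X) → ∃[ σ ] Simplex X σ × Unique σ × v ∈ σ ×
        (∀ w → w ∉ σ → coord x w ≃ 0ℝ) × ∑ σ (coord x) ≃ 1ℝ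
      supportWithApex x with supported x
      ... | σ , simp , uniq , outside , total with v ∈? σ
      ...   | yes v∈ = σ , simp , uniq , v∈ , outside , total
      ...   | no  v∉ = v ∷ σ , join simp , ¬Any⇒All¬ σ v∉ ∷ uniq , here refl ,
        (λ w w∉ → outside w (w∉ ∘ there)) ,
        ≃-trans {coord x v + ∑ σ (coord x)} {0ℝ + 1ℝ} {1ℝ}
          (+-cong {coord x v} {0ℝ} {∑ σ (coord x)} {1ℝ} (outside v v∉) total)
          (≡⇒≃ {0ℝ + 1ℝ} {1ℝ} λ _ → ℚ.+-identityˡ 1ℚ)

      clamp-coord : ∀ (x : Point X) w → clampℝ (coord x w) ≃ coord x w
      clamp-coord x w = clampℝ-≃ (coord x w) (coord≥0 x w) (coord≤1 x w)

      module _ (x : Point X) (t : Interval) where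

        private
          y clamped : V → ℝ
          y w = towards v (value t) (coord x) w
          clamped w = clampℝ (coord x w)

          T∈ : ∀ n → InUnit (clamp (seq (value t) n))
          T∈ n = clamp-inUnit (seq (value t) n)

        contract-nonneg : ∀ w → 0ℝ ≤ y w
        contract-nonneg w ε 0<ε = always λ n → ℚ.≤-trans
          (lerp-nonneg {clamp (seq (value t) n)} {clamp (seq (coord x w) n)} {indicator v w}
            (T∈ n)
            (proj₁ (clamp-inUnit (seq (coord x w) n)))
            (proj₁ (indicator-inUnit v w)))
          (p≤p+q _ (ℚ.<⇒≤ 0<ε))

        contract-outside : ∀ {σ} → v ∈ σ → (∀ w → w ∉ σ → coord x w ≃ 0ℝ) →
                           ∀ w → w ∉ σ → y w ≃ 0ℝ
        contract-outside v∈ outside w w∉ = ≃-dominated {y w} {0ℝ} {clamped w} {0ℝ}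
          (λ n → lerp-near (seq (clamped w) n) (seq 0ℝ n) {seq (y w) n} (T∈ n)
            (cong (lerp (clamp (seq (value t) n)) (seq (clamped w) n))
              (indicator-other {v} {w} λ { refl → w∉ v∈ })))
          (≃-trans {clamped w} {coord x w} {0ℝ} (clamp-coord x w) (outside w w∉))

        -- Summation commutes with interpolation, and both endpoints, the clamped coordinates and
        -- the indicator of `v`, sum to 1 over `σ`.
        contract-total : ∀ {σ} → v ∈ σ → Unique σ → ∑ σ (coord x) ≃ 1ℝ → ∑ σ y ≃ 1ℝ
        contract-total {σ} v∈ uniq total = ≃-dominated {∑ σ y} {1ℝ} {∑ σ clamped} {1ℝ}
          (λ n → lerp-near (seq (∑ σ clamped) n) (seq 1ℝ n) {seq (∑ σ y) n} (T∈ n)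
            (trans (seq-∑-lerp (clamp (seq (value t) n)) n y clamped (indicatorℝ v)
                     (λ _ → refl) σ)
              (cong (lerp (clamp (seq (value t) n)) (seq (∑ σ clamped) n))
                {seq (∑ σ (indicatorℝ v)) n} {seq 1ℝ n} (∑-indicator-∈ uniq v∈ n))))
          (≃-trans {∑ σ clamped} {∑ σ (coord x)} {1ℝ}
            (∑-cong σ {clamped} {coord x} (clamp-coord x)) total)

        contract : Point X
        contract = record
          { coord     = y
          ; coord≥0   = contract-nonneg
          ; supported = let (σ , simp , uniq , v∈ , outside , total) = supportWithApex x in
              σ , simp , uniq , contract-outside v∈ outside , contract-total v∈ uniq total
          }

      contract-continuous : Continuous contract
      -- The coordinate and the parameter each contribute at most δ = ε/2, and each of these two
      -- real inequalities is used with slack η/2.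
      contract-continuous x t ε 0<ε = ε ℚ.* ½ , half-pos 0<ε , λ y s near-x near-t w η 0<η →
        zipᵉ (λ n p q → ℚ.≤-trans
            (lerp-clamp-lipschitz {seq (value t) n} {seq (value s) n}
              {seq (coord x w) n} {seq (coord y w) n} (indicator-inUnit v w))
            (ℚ.≤-trans (ℚ.+-mono-≤ p q) (ℚ.≤-reflexive (regroup η))))
          (near-x w (η ℚ.* ½) (half-pos 0<η)) (near-t (η ℚ.* ½) (half-pos 0<η))
        where
        open ℚSolver.+-*-Solver
        interchange : ∀ a b → (a ℚ.+ b) ℚ.+ (a ℚ.+ b) ≡ (a ℚ.+ a) ℚ.+ (b ℚ.+ b)
        interchange = solve 2 (λ a b → (a :+ b) :+ (a :+ b) := (a :+ a) :+ (b :+ b)) refl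
        regroup : ∀ η → (ε ℚ.* ½ ℚ.+ η ℚ.* ½) ℚ.+ (ε ℚ.* ½ ℚ.+ η ℚ.* ½) ≡ ε ℚ.+ η
        regroup η = trans (interchange (ε ℚ.* ½) (η ℚ.* ½)) (cong₂ ℚ._+_ (halves ε) (halves η))

      cone-contractible : Contractible X
      cone-contractible = record
        { base       = vertexPoint
        ; homotopy   = contract
        ; continuous = contract-continuous
        ; at-0       = λ x w →
            lerpℝ-0 (coord x w) (indicator-inUnit v w) (coord≥0 x w) (coord≤1 x w)
        ; at-1       = λ x w →
            ≡⇒≃ {lerpℝ 1ℝ (coord x w) (indicator v w) (indicator-inUnit v w)}
                {indicatorℝ v w}
              λ n → lerp-1 (clamp (seq (coord x w) n)) (indicator v w)
        }

-- Column lengths of Ferrers diagrams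

-- The Kronecker delta, by the same recursion as `cell`, so that the two reduce in step.
δ : ℕ → ℕ → ℕ
δ zero    zero    = 1
δ zero    (suc _) = 0
δ (suc _) zero    = 0
δ (suc x) (suc m) = δ x m

δ-self : ∀ x → δ x x ≡ 1
δ-self zero    = refl
δ-self (suc x) = δ-self x

δ-other : ∀ {x m} → x ≢ m → δ x m ≡ 0
δ-other {zero}  {zero}  x≢m = ⊥-elim (x≢m refl)
δ-other {zero}  {suc m} x≢m = refl
δ-other {suc x} {zero}  x≢m = refl
δ-other {suc x} {suc m} x≢m = δ-other (x≢m ∘ cong suc)

δ-injective : ∀ x y → (∀ m → δ x m ≡ δ y m) → x ≡ y
δ-injective x y e with x ℕ.≟ y
... | yes x≡y = x≡y
... | no  x≢y with trans (sym (trans (e x) (δ-other (x≢y ∘ sym)))) (δ-self x)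
...   | ()

-- The number (0 or 1) of cells in column m of a row of length x.
cell : ℕ → ℕ → ℕ
cell zero    _       = 0
cell (suc x) zero    = 1
cell (suc x) (suc m) = cell x m

cell-suc : ∀ x m → cell (suc x) m ≡ cell x m ℕ.+ δ x m
cell-suc zero    zero    = refl
cell-suc zero    (suc m) = refl
cell-suc (suc x) zero    = refl
cell-suc (suc x) (suc m) = cell-suc x m

cell-pred : ∀ {x} m → 0 ℕ.< x → cell x m ≡ cell (pred x) m ℕ.+ δ (pred x) m
cell-pred {suc x} m _ = cell-suc x m

cell-< : ∀ {x m} → m ℕ.< x → cell x m ≡ 1
cell-< {suc x} {zero}  _         = refl
cell-< {suc x} {suc m} (s≤s m<x) = cell-< m<x

cell-≥ : ∀ {x m} → x ℕ.≤ m → cell x m ≡ 0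
cell-≥ {zero}          _         = refl
cell-≥ {suc x} {suc m} (s≤s x≤m) = cell-≥ x≤m

cell-antitone : ∀ x m → cell x (suc m) ℕ.≤ cell x m
cell-antitone zero          m       = z≤n
cell-antitone (suc zero)    zero    = z≤n
cell-antitone (suc (suc x)) zero    = s≤s z≤n
cell-antitone (suc x)       (suc m) = cell-antitone x m

cell-flat : ∀ {x m} → suc m ≢ x → cell x (suc m) ≡ cell x m
cell-flat {zero}        {m}     _ = refl
cell-flat {suc zero}    {zero}  ne = ⊥-elim (ne refl)
cell-flat {suc (suc x)} {zero}  _ = refl
cell-flat {suc x}       {suc m} ne = cell-flat {x} {m} (ne ∘ cong suc)

-- The conjugate partition as a function: the number of entries exceeding `m`. It is defined for
-- unsorted lists too, as transfers are sorted only up to permutation.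
col : List ℕ → ℕ → ℕ
col []       m = 0
col (x ∷ xs) m = cell x m ℕ.+ col xs m

col-↭ : ∀ {xs ys} → xs ↭ ys → ∀ m → col xs m ≡ col ys m
col-↭ Perm.refl          m = refl
col-↭ (prep x p)         m = cong (cell x m ℕ.+_) (col-↭ p m)
col-↭ (Perm.trans p q)   m = trans (col-↭ p m) (col-↭ q m)
col-↭ (swap {xs} {ys} x y p) m =
  trans (cong (λ z → cell x m ℕ.+ (cell y m ℕ.+ z)) (col-↭ p m))
        (solve 3 (λ a b c → a :+ (b :+ c) := b :+ (a :+ c)) refl
          (cell x m) (cell y m) (col ys m))
  where open +-*-Solver

col-filter : ∀ xs m → col (filter (0 ℕ.<?_) xs) m ≡ col xs m
col-filter []           m = refl
col-filter (zero  ∷ xs) m = col-filter xs m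
col-filter (suc x ∷ xs) m = cong (cell (suc x) m ℕ.+_) (col-filter xs m)

col-antitone : ∀ xs m → col xs (suc m) ℕ.≤ col xs m
col-antitone []       m = z≤n
col-antitone (x ∷ xs) m = ℕ.+-mono-≤ (cell-antitone x m) (col-antitone xs m)

-- By `cell-flat`, a row contributes equally to columns `m` and `suc m` unless its length is
-- `suc m`; a drop therefore exhibits such a row.
drop⇒∈ : ∀ {m} xs → col xs (suc m) ℕ.< col xs m → suc m ∈ xs
drop⇒∈ {m} (x ∷ xs) lt with suc m ℕ.≟ x
... | yes e = here e
... | no ne rewrite cell-flat ne = there (drop⇒∈ xs (ℕ.+-cancelˡ-< (cell x m) _ _ lt))

-- A first row of length `suc x` makes the column lengths drop after column `x`. The same drop in
-- `ys` exhibits a row of that length there; removing it from both lists leaves equal column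
-- lengths. Empty rows are invisible to `col`, whence the positivity hypotheses.
col-injective : ∀ {xs ys} → All (0 ℕ.<_) xs → All (0 ℕ.<_) ys →
                (∀ m → col xs m ≡ col ys m) → xs ↭ ys
col-injective {[]} {[]} _ _ e = Perm.refl
col-injective {[]} {zero ∷ ys} _ (() ∷ _) e
col-injective {[]} {suc y ∷ ys} _ _ e with e 0
... | ()
col-injective {suc x ∷ xs} {ys} (_ ∷ xs>0) ys>0 e
  with ∈-∃++ (drop⇒∈ ys (subst₂ ℕ._<_ (e (suc x)) (e x)
    (subst₂ (λ a b → a ℕ.+ col xs (suc x) ℕ.< b ℕ.+ col xs x)
      (sym (cell-≥ {suc x} ℕ.≤-refl)) (sym (cell-< {suc x} ℕ.≤-refl))
      (s≤s (col-antitone xs x)))))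
... | as , bs , refl = Perm.trans
  (prep (suc x) (col-injective xs>0 (All.tail (All-resp-↭ (shift (suc x) as bs) ys>0))
    λ m → ℕ.+-cancelˡ-≡ (cell (suc x) m) _ _
      (trans (e m) (col-↭ (shift (suc x) as bs) m))))
  (↭-sym (shift (suc x) as bs))

-- Conjugation between rows and columns.

nth-step : ∀ {xs} → Linked _≥_ xs → ∀ i → nth xs (suc i) ℕ.≤ nth xs i
nth-step []       i       = z≤n
nth-step [-]      i       = z≤n
nth-step (p ∷ ps) zero    = p
nth-step (p ∷ ps) (suc i) = nth-step ps i

nth≤head : ∀ {x xs} → Linked _≥_ (x ∷ xs) → ∀ k → nth (x ∷ xs) k ℕ.≤ x
nth≤head dec zero    = ℕ.≤-refl
nth≤head dec (suc k) = ℕ.≤-trans (nth-step dec k) (nth≤head dec k)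

nth>0⇒<length : ∀ xs i → 0 ℕ.< nth xs i → i ℕ.< length xs
nth>0⇒<length (x ∷ xs) zero    _ = s≤s z≤n
nth>0⇒<length (x ∷ xs) (suc i) p = s≤s (nth>0⇒<length xs i p)

-- Rows weakly decrease, so those reaching column `m` form an initial segment, of size `col xs m`.
-- This and `col⇒nth` are the two directions of the resulting equivalence.
nth⇒col : ∀ {xs m} → Linked _≥_ xs → ∀ k → m ℕ.< nth xs k → k ℕ.< col xs m
nth⇒col {x ∷ xs} dec zero m<x rewrite cell-< m<x = s≤s z≤n
nth⇒col {x ∷ xs} dec (suc k) m<
  rewrite cell-< (ℕ.≤-trans m< (nth≤head dec (suc k))) =
  s≤s (nth⇒col (Linked.tail dec) k m<)

col⇒nth : ∀ {xs m} → Linked _≥_ xs → ∀ k → k ℕ.< col xs m → m ℕ.< nth xs k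
col⇒nth {x ∷ xs} {m} dec k k< with m ℕ.<? x
col⇒nth {x ∷ xs} {m} dec zero    k< | yes m<x = m<x
col⇒nth {x ∷ xs} {m} dec (suc k) k< | yes m<x rewrite cell-< m<x =
  col⇒nth (Linked.tail dec) k (ℕ.≤-pred k<)
... | no m≮x rewrite cell-≥ (ℕ.≮⇒≥ m≮x) = ⊥-elim
  (m≮x (ℕ.≤-trans (col⇒nth (Linked.tail dec) k k<) (nth≤head dec (suc k))))

nth-injective : ∀ {xs ys} → All (0 ℕ.<_) xs → All (0 ℕ.<_) ys →
                (∀ k → nth xs k ≡ nth ys k) → xs ≡ ys
nth-injective []       []       e = refl
nth-injective []       (p ∷ _)  e = ⊥-elim (ℕ.<-irrefl (e 0) p)
nth-injective (p ∷ _)  []       e = ⊥-elim (ℕ.<-irrefl (sym (e 0)) p)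
nth-injective (_ ∷ ps) (_ ∷ qs) e = cong₂ _∷_ (e 0) (nth-injective ps qs (e ∘ suc))

-- Column lengths after a change in one row.

update-other : ∀ {i k} g r → k ≢ i → update i g r k ≡ r k
update-other {zero}  {zero}  g r k≢i = ⊥-elim (k≢i refl)
update-other {zero}  {suc k} g r k≢i = refl
update-other {suc i} {zero}  g r k≢i = refl
update-other {suc i} {suc k} g r k≢i = update-other g (r ∘ suc) (k≢i ∘ cong suc)

update-self : ∀ i g r → update i g r i ≡ g (r i)
update-self zero    g r = refl
update-self (suc i) g r = update-self i g (r ∘ suc)

-- Only the summand of row `i` changes; its old and new values stand on opposite sides to avoid
-- subtraction.
col-update : ∀ {N} i g r m → i ℕ.< N →
  col (applyUpTo (update i g r) N) m ℕ.+ cell (r i) m ≡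
  col (applyUpTo r N) m ℕ.+ cell (g (r i)) m
col-update {suc N} zero g r m _ =
  solve 3 (λ a b c → (a :+ b) :+ c := (c :+ b) :+ a) refl
    (cell (g (r 0)) m) (col (applyUpTo (r ∘ suc) N) m) (cell (r 0) m)
  where open +-*-Solver
col-update {suc N} (suc i) g r m (s≤s i<N) =
  trans (ℕ.+-assoc (cell (r 0) m) _ _)
    (trans (cong (cell (r 0) m ℕ.+_) (col-update i g (r ∘ suc) m i<N))
      (sym (ℕ.+-assoc (cell (r 0) m) _ _)))

-- The bound `suc (length xs)` includes the first empty row, available for an added cell, which
-- contributes nothing.
col-nth : ∀ xs m → col (applyUpTo (nth xs) (suc (length xs))) m ≡ col xs m
col-nth []       m = refl
col-nth (x ∷ xs) m = cong (cell x m ℕ.+_) (col-nth xs m)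

allOrAny : ∀ {A : Set} {P Q : A → Set} {xs} →
           All (λ x → P x ⊎ Q x) xs → All P xs ⊎ Any Q xs
allOrAny []            = inj₁ []
allOrAny (inj₂ q ∷ _)  = inj₂ (here q)
allOrAny (inj₁ p ∷ ps) = Sum.map (p ∷_) there (allOrAny ps)

-- Partitions and transfers as shifts between columns.

module _ {n : ℕ} where

  parts-injective : {α β : Partition n} → parts α ≡ parts β → α ≡ β
  parts-injective {mkPartition _ d p t} {mkPartition _ d′ p′ t′} refl
    with Linked.irrelevant ℕ.≤-irrelevant d d′
       | All.irrelevant ℕ.≤-irrelevant p p′
       | ℕ.≡-irrelevant t t′
  ... | refl | refl | refl = refl

  _≟ᵖ_ : DecidableEquality (Partition n)
  α ≟ᵖ β = map′ parts-injective (cong parts) (≡-dec ℕ._≟_ (parts α) (parts β))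

  column : Partition n → ℕ → ℕ
  column α = col (parts α)

  row⇒column : ∀ (α : Partition n) {m k} → m ℕ.< row α k → k ℕ.< column α m
  row⇒column α {k = k} = nth⇒col (decreasing α) k

  column⇒row : ∀ (α : Partition n) {m k} → k ℕ.< column α m → m ℕ.< row α k
  column⇒row α {k = k} = col⇒nth (decreasing α) k

  row-≤ : ∀ {α β : Partition n} → (∀ m → column α m ≡ column β m) →
             ∀ k → row α k ℕ.≤ row β k
  row-≤ {α} {β} e k = ℕ.≮⇒≥ λ lt →
    ℕ.<-irrefl refl (column⇒row β (subst (k ℕ.<_) (e (row β k)) (row⇒column α lt)))

  column-injective : ∀ {α β : Partition n} → (∀ m → column α m ≡ column β m) → α ≡ β
  column-injective {α} {β} e = parts-injective (nth-injective (positive α) (positive β)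
    λ k → ℕ.≤-antisym (row-≤ {α} {β} e k) (row-≤ {β} {α} (sym ∘ e) k))

  -- β arises from α by moving a cell from column p to column q; the removed
  -- cell is added on the left to avoid truncated subtraction.
  Shift : Partition n → ℕ → ℕ → Partition n → Set
  Shift α p q β = ∀ m → column β m ℕ.+ δ p m ≡ column α m ℕ.+ δ q m

  shift-sym : ∀ {α p q β} → Shift α p q β → Shift β q p α
  shift-sym s m = sym (s m)

  shift-trivial : ∀ {α p β} → Shift α p p β → β ≡ α
  shift-trivial {α} {p} {β} s = column-injective {β} {α} λ m → ℕ.+-cancelʳ-≡ (δ p m) _ _ (s m)

  shift-proper : ∀ {α p q β} → Shift α p q β → β ≢ α → p ≢ q
  shift-proper {p = p} s β≢α refl = β≢α (shift-trivial {p = p} s)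

  shift-≢ : ∀ {α p q β} → Shift α p q β → p ≢ q → β ≢ α
  shift-≢ {α} {p} {q} s p≢q refl =
    p≢q (δ-injective p q λ m → ℕ.+-cancelˡ-≡ (column α m) _ _ (s m))

  transferred : Partition n → ℕ → ℕ → List ℕ
  transferred α i j = filter (0 ℕ.<?_)
    (applyUpTo (update j suc (update i pred (row α))) (suc (ℓ α)))

  -- Columns are numbered from 0: the last cell of a row of length x lies in column x - 1, and a
  -- cell added to a row of length y lies in column y.
  col-transfer : ∀ (α : Partition n) i j m → 0 ℕ.< row α i → j ℕ.≤ ℓ α → i ≢ j →
    col (transferred α i j) m ℕ.+ δ (pred (row α i)) m
    ≡ column α m ℕ.+ δ (row α j) m
  col-transfer α i j m 0<r j≤ℓ i≢j = trans
    (cong (ℕ._+ δ (pred (r i)) m) (col-filter (applyUpTo g N) m))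
    (combine (col (applyUpTo g N) m) (col (applyUpTo f N) m) (column α m)
      (cell (pred (r i)) m) (δ (pred (r i)) m) (cell (r j) m) (δ (r j) m)
      (subst₂ (λ x y → col (applyUpTo f N) m ℕ.+ x ≡ y ℕ.+ cell (pred (r i)) m)
        (cell-pred m 0<r) (col-nth (parts α) m)
        (col-update i pred r m (ℕ.m≤n⇒m≤1+n (nth>0⇒<length (parts α) i 0<r))))
      (trans
        (subst (λ x → col (applyUpTo g N) m ℕ.+ cell x m
                    ≡ col (applyUpTo f N) m ℕ.+ cell (suc x) m)
          -- As `i ≢ j`, row `j` still has its original length when its cell is added.
          (update-other pred r (i≢j ∘ sym)) (col-update j suc f m (s≤s j≤ℓ)))
        (cong (col (applyUpTo f N) m ℕ.+_) (cell-suc (r j) m))))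
    where
    open +-*-Solver
    N = suc (ℓ α)
    r = row α
    f = update i pred r
    g = update j suc f
    combine : ∀ T U C a d b e →
      U ℕ.+ (a ℕ.+ d) ≡ C ℕ.+ a → T ℕ.+ b ≡ U ℕ.+ (b ℕ.+ e) → T ℕ.+ d ≡ C ℕ.+ e
    combine T U C a d b e A B = ℕ.+-cancelʳ-≡ (a ℕ.+ b) _ _ (begin
      (T ℕ.+ d) ℕ.+ (a ℕ.+ b)
        ≡⟨ solve 4 (λ T d a b → (T :+ d) :+ (a :+ b) := (T :+ b) :+ (a :+ d)) refl T d a b ⟩
      (T ℕ.+ b) ℕ.+ (a ℕ.+ d)
        ≡⟨ cong (ℕ._+ (a ℕ.+ d)) B ⟩
      (U ℕ.+ (b ℕ.+ e)) ℕ.+ (a ℕ.+ d)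
        ≡⟨ solve 4 (λ U x b e → (U :+ (b :+ e)) :+ x := (U :+ x) :+ (b :+ e)) refl U (a ℕ.+ d) b e ⟩
      (U ℕ.+ (a ℕ.+ d)) ℕ.+ (b ℕ.+ e)
        ≡⟨ cong (ℕ._+ (b ℕ.+ e)) A ⟩
      (C ℕ.+ a) ℕ.+ (b ℕ.+ e)
        ≡⟨ solve 4 (λ C a b e → (C :+ a) :+ (b :+ e) := (C :+ e) :+ (a :+ b)) refl C a b e ⟩
      (C ℕ.+ e) ℕ.+ (a ℕ.+ b) ∎)
      where open ≡-Reasoning

  transfer⇒shift : ∀ {α i j β} → 0 ℕ.< row α i → j ℕ.≤ ℓ α → i ≢ j →
    Transfer α i j β → Shift α (pred (row α i)) (row α j) β
  transfer⇒shift {α} {i} {j} 0<r j≤ℓ i≢j t m =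
    trans (cong (ℕ._+ δ (pred (row α i)) m) (sym (col-↭ t m)))
      (col-transfer α i j m 0<r j≤ℓ i≢j)

  shift⇒transfer : ∀ {α i j β} → 0 ℕ.< row α i → j ℕ.≤ ℓ α → i ≢ j →
    Shift α (pred (row α i)) (row α j) β → Transfer α i j β
  shift⇒transfer {α} {i} {j} {β} 0<r j≤ℓ i≢j s =
    col-injective
      (all-filter (0 ℕ.<?_)
        (applyUpTo (update j suc (update i pred (row α))) (suc (ℓ α))))
      (positive β) λ m →
      ℕ.+-cancelʳ-≡ (δ (pred (row α i)) m) (col (transferred α i j) m) (column β m)
        (trans (col-transfer α i j m 0<r j≤ℓ i≢j) (sym (s m)))

-- Corners

  removable⇒row>0 : ∀ {α : Partition n} {c} → Removable α c → 0 ℕ.< row α c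
  removable⇒row>0 rem = ℕ.≤-trans (s≤s z≤n) rem

  addable⇒row< : ∀ {α : Partition n} {i} → Addable α (suc i) →
                 row α (suc i) ℕ.< row α i
  addable⇒row< {α} {i} add = subst₂ ℕ._≤_
    (update-self (suc i) suc (row α))
    (update-other {suc i} {i} suc (row α) (ℕ.<⇒≢ ℕ.≤-refl))
    (add i)

  addable⇒≤ℓ : ∀ {α : Partition n} {a} → Addable α a → a ℕ.≤ ℓ α
  addable⇒≤ℓ {a = zero}      _   = z≤n
  addable⇒≤ℓ {α} {a = suc i} add = nth>0⇒<length (parts α) i
    (ℕ.≤-trans (s≤s z≤n) (addable⇒row< {α} add))

  -- Row `c` reaches column `p` while row `suc c` does not, so row `c` is strictly longer.
  last-row-removable : ∀ {α : Partition n} {p c} → column α p ≡ suc c → Removable α c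
  last-row-removable {α} {p} {c} e = ℕ.≤-trans
    (s≤s (ℕ.≮⇒≥ λ lt → ℕ.<-irrefl (sym e) (row⇒column α {p} {suc c} lt)))
    (column⇒row α (ℕ.≤-reflexive (sym e)))

  -- Lengthening row `a` can only violate the inequality with the row directly above; for `a = 0`
  -- there is none.
  addable-intro : ∀ {α : Partition n} {a} →
                  (∀ i → suc i ≡ a → row α a ℕ.< row α i) → Addable α a
  addable-intro {α} {a} lt i with suc i ℕ.≟ a | i ℕ.≟ a
  ... | yes refl | _ = subst₂ ℕ._≤_
    (sym (update-self a suc (row α)))
    (sym (update-other {a} {i} suc (row α) (ℕ.<⇒≢ ℕ.≤-refl)))
    (lt i refl)
  ... | no ne | yes refl = subst₂ ℕ._≤_
    (sym (update-other {a} {suc i} suc (row α) ne))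
    (sym (update-self a suc (row α)))
    (ℕ.m≤n⇒m≤1+n (nth-step (decreasing α) i))
  ... | no ne | no ne′ = subst₂ ℕ._≤_
    (sym (update-other {a} {suc i} suc (row α) ne))
    (sym (update-other {a} {i} suc (row α) ne′))
    (nth-step (decreasing α) i)

  -- Recovering the two corners from a shift.

  module _ {α p q β} (s : Shift α p q β) (p≢q : p ≢ q) where

    private
      drop-at-p : suc (column β p) ≡ column α p
      drop-at-p = begin
        suc (column β p)         ≡⟨ ℕ.+-comm 1 (column β p) ⟩
        column β p ℕ.+ 1         ≡⟨ cong (column β p ℕ.+_) (sym (δ-self p)) ⟩
        column β p ℕ.+ δ p p     ≡⟨ s p ⟩
        column α p ℕ.+ δ q p     ≡⟨ cong (column α p ℕ.+_) (δ-other (p≢q ∘ sym)) ⟩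
        column α p ℕ.+ 0         ≡⟨ ℕ.+-identityʳ (column α p) ⟩
        column α p               ∎
        where open ≡-Reasoning

      grow-off-p : ∀ {m} → p ≢ m → column α m ℕ.≤ column β m
      grow-off-p {m} p≢m = begin
        column α m           ≤⟨ ℕ.m≤m+n (column α m) (δ q m) ⟩
        column α m ℕ.+ δ q m ≡⟨ sym (s m) ⟩
        column β m ℕ.+ δ p m ≡⟨ cong (column β m ℕ.+_) (δ-other p≢m) ⟩
        column β m ℕ.+ 0     ≡⟨ ℕ.+-identityʳ (column β m) ⟩
        column β m           ∎
        where open ℕ.≤-Reasoning

      shrink-off-q : ∀ {m} → q ≢ m → column β m ℕ.≤ column α m
      shrink-off-q {m} q≢m = begin
        column β m           ≤⟨ ℕ.m≤m+n (column β m) (δ p m) ⟩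
        column β m ℕ.+ δ p m ≡⟨ s m ⟩
        column α m ℕ.+ δ q m ≡⟨ cong (column α m ℕ.+_) (δ-other q≢m) ⟩
        column α m ℕ.+ 0     ≡⟨ ℕ.+-identityʳ (column α m) ⟩
        column α m           ∎
        where open ℕ.≤-Reasoning

      grow-at-q : column β q ≡ suc (column α q)
      grow-at-q = begin
        column β q           ≡⟨ sym (ℕ.+-identityʳ (column β q)) ⟩
        column β q ℕ.+ 0     ≡⟨ cong (column β q ℕ.+_) (sym (δ-other p≢q)) ⟩
        column β q ℕ.+ δ p q ≡⟨ s q ⟩
        column α q ℕ.+ δ q q ≡⟨ cong (column α q ℕ.+_) (δ-self q) ⟩
        column α q ℕ.+ 1     ≡⟨ ℕ.+-comm (column α q) 1 ⟩
        suc (column α q)     ∎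
        where open ≡-Reasoning

    shift⇒removable : ∃[ c ] Removable α c × pred (row α c) ≡ p
    -- The corner is the bottom cell of column `p`. Its row ends there: if it reached column
    -- `suc p`, that column, which the shift does not shorten, would be longer in `β` than column
    -- `p`.
    shift⇒removable = c , last-row-removable {α} {p} (sym drop-at-p) ,
      cong pred (ℕ.≤-antisym
        (ℕ.≮⇒≥ λ lt → ℕ.<-irrefl refl (ℕ.≤-trans (row⇒column α lt)
          (ℕ.≤-trans (grow-off-p (ℕ.<⇒≢ ℕ.≤-refl)) (col-antitone (parts β) p))))
        (column⇒row α (ℕ.≤-reflexive drop-at-p)))
      where c = column β p

    shift⇒addable : ∃[ a ] Addable α a × row α a ≡ q
    shift⇒addable = a , addable-intro {α} above , row≡q
      where
      -- The first row not meeting column `q`.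
      a = column α q

      -- The equation permits a case split although `q` is a fixed parameter. For positive `q`, the
      -- grown column `q` of `β` forces column `q - 1`, which the shift does not lengthen, to reach
      -- row `a` already in `α`.
      q≤row : ∀ q′ → q′ ≡ q → q′ ℕ.≤ row α a
      q≤row zero     _    = z≤n
      q≤row (suc q′) refl = column⇒row α (begin
        suc a          ≡⟨ sym grow-at-q ⟩
        column β q     ≤⟨ col-antitone (parts β) q′ ⟩
        column β q′    ≤⟨ shrink-off-q (ℕ.<⇒≢ ℕ.≤-refl ∘ sym) ⟩
        column α q′    ∎)
        where open ℕ.≤-Reasoning

      row≡q : row α a ≡ q
      row≡q = ℕ.≤-antisym (ℕ.≮⇒≥ λ lt → ℕ.<-irrefl refl (row⇒column α {q} {a} lt))
                          (q≤row q refl)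

      above : ∀ i → suc i ≡ a → row α a ℕ.< row α i
      above i e = subst (ℕ._< row α i) (sym row≡q) (column⇒row α (ℕ.≤-reflexive e))

    -- If the corners shared a row, then q = p + 1 and that row would be the only one of its length.
    -- After the shift, column `p` would be shorter than column `p + 1`, impossible in the partition
    -- `β`.
    shift⇒distinct : ∀ {c a} → Removable α c → pred (row α c) ≡ p →
                     Addable α a → row α a ≡ q → c ≢ a
    shift⇒distinct {c} {a} rem refl add refl refl = ℕ.<-irrefl refl (begin
      suc (column β p)       ≡⟨ drop-at-p ⟩
      column α p             ≤⟨ ℕ.≮⇒≥ (λ lt → ℕ.<-irrefl refl (ℕ.≤-trans (column⇒row α lt) row≤p)) ⟩
      suc c                  ≤⟨ s≤s (c≤ c refl) ⟩
      suc (column α q)       ≡⟨ sym grow-at-q ⟩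
      column β q             ≡⟨ cong (column β) (sym 1+p≡q) ⟩
      column β (suc p)       ≤⟨ col-antitone (parts β) p ⟩
      column β p             ∎)
      where
      open ℕ.≤-Reasoning
      1+p≡q : suc p ≡ q
      1+p≡q = ℕ.suc-pred (row α c) {{ℕ.>-nonZero (removable⇒row>0 {α} rem)}}
      row≤p : row α (suc c) ℕ.≤ p
      row≤p = ℕ.≤-pred (subst (row α (suc c) ℕ.<_) (sym 1+p≡q) rem)
      c≤ : ∀ k → k ≡ c → k ℕ.≤ column α q
      c≤ zero    _    = z≤n
      c≤ (suc k) refl = row⇒column α (addable⇒row< {α} add)

    shift⇒admissible : ∀ {c a} → Removable α c → pred (row α c) ≡ p →
                       Addable α a → row α a ≡ q → Admissible α c a β
    shift⇒admissible {c} {a} rem refl add refl =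
      c≢a , shift⇒transfer {α} {c} {a} {β} (removable⇒row>0 {α} rem) (addable⇒≤ℓ {α} add) c≢a s ,
      shift-≢ {α} {p} {q} {β} s p≢q
      where c≢a = shift⇒distinct rem refl add refl

    shift⇒move : Move α β
    shift⇒move with shift⇒removable | shift⇒addable
    ... | c , rem , ec | a , add , ea with shift⇒admissible rem ec add ea
    ...   | c≢a , t , _ =
      c , a , removable⇒row>0 {α} rem , addable⇒≤ℓ {α} add , c≢a , t

  admissible⇒shift : ∀ {α c a β} → Removable α c → Addable α a → Admissible α c a β →
                     Shift α (pred (row α c)) (row α a) β
  admissible⇒shift {α} {c} {a} {β} rem add (c≢a , t , _) =
    transfer⇒shift {α} {c} {a} {β} (removable⇒row>0 {α} rem) (addable⇒≤ℓ {α} add) c≢a t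

  move⇒shift : ∀ {α β} → Move α β → ∃[ p ] ∃[ q ] Shift α p q β
  move⇒shift {α} {β} (i , j , 0<r , j≤ℓ , i≢j , t) =
    pred (row α i) , row α j , transfer⇒shift {α} {i} {j} {β} 0<r j≤ℓ i≢j t

  adjacent⇒shift : ∀ {α β} → Adjacent α β → ∃[ p ] ∃[ q ] Shift α p q β
  adjacent⇒shift {α} {β} (_ , inj₁ mv) = move⇒shift {α} {β} mv
  adjacent⇒shift {α} {β} (_ , inj₂ mv) with move⇒shift {β} {α} mv
  ... | p , q , s = q , p , shift-sym {β} {p} {q} {α} s

  shift⇒adjacent : ∀ {α p q β} → Shift α p q β → α ≢ β → Adjacent α β
  shift⇒adjacent {α} {p} {q} {β} s α≢β =
    α≢β , inj₁ (shift⇒move {α} {p} {q} {β} s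
      (shift-proper {α} {p} {q} {β} s (α≢β ∘ sym)))

  -- The trivial shift p = q accounts for the vertex α itself.
  star⇒shift : ∀ {α c β} → Removable α c → StarVertex α c β →
               ∃[ q ] Shift α (pred (row α c)) q β
  star⇒shift {α} {c} rem (inj₁ refl) = pred (row α c) , λ _ → refl
  star⇒shift {α} {c} {β} rem (inj₂ (a , add , ad)) =
    row α a , admissible⇒shift {α} {c} {a} {β} rem add ad

  shift⇒star : ∀ {α c q β} → Removable α c → Shift α (pred (row α c)) q β →
               StarVertex α c β
  shift⇒star {α} {c} {q} {β} rem s with pred (row α c) ℕ.≟ q
  ... | yes refl = inj₁ (shift-trivial {α} {q} {β} s)
  ... | no  p≢q  with shift⇒addable {α} {pred (row α c)} {q} {β} s p≢q
  ...   | a , add , e = inj₂ (a , add ,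
    shift⇒admissible {α} {pred (row α c)} {q} {β} s p≢q {c} {a} rem refl add e)

  top⇒shift : ∀ {α a β} → Addable α a → TopVertex α a β →
              ∃[ p ] Shift α p (row α a) β
  top⇒shift {α} {a} add (inj₁ refl) = row α a , λ _ → refl
  top⇒shift {α} {a} {β} add (inj₂ (c , rem , ad)) =
    pred (row α c) , admissible⇒shift {α} {c} {a} {β} rem add ad

  shift⇒top : ∀ {α a p β} → Addable α a → Shift α p (row α a) β → TopVertex α a β
  shift⇒top {α} {a} {p} {β} add s with p ℕ.≟ row α a
  ... | yes refl = inj₁ (shift-trivial {α} {p} {β} s)
  ... | no  p≢q  with shift⇒removable {α} {p} {row α a} {β} s p≢q
  ...   | c , rem , e = inj₂ (c , rem ,
    shift⇒admissible {α} {p} {row α a} {β} s p≢q {c} {a} rem e add refl)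

  -- Shifts with a common source or target.

  shift-common-source : ∀ {α p q q′ β γ} →
    Shift α p q β → Shift α p q′ γ → Shift β q q′ γ
  shift-common-source {α} {p} {q} {q′} {β} {γ} s t m = ℕ.+-cancelʳ-≡ (δ p m) _ _ (begin
    (column γ m ℕ.+ δ q m) ℕ.+ δ p m  ≡⟨ swapʳ (column γ m) (δ q m) (δ p m) ⟩
    (column γ m ℕ.+ δ p m) ℕ.+ δ q m  ≡⟨ cong (ℕ._+ δ q m) (t m) ⟩
    (column α m ℕ.+ δ q′ m) ℕ.+ δ q m ≡⟨ swapʳ (column α m) (δ q′ m) (δ q m) ⟩
    (column α m ℕ.+ δ q m) ℕ.+ δ q′ m ≡⟨ cong (ℕ._+ δ q′ m) (sym (s m)) ⟩
    (column β m ℕ.+ δ p m) ℕ.+ δ q′ m ≡⟨ swapʳ (column β m) (δ p m) (δ q′ m) ⟩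
    (column β m ℕ.+ δ q′ m) ℕ.+ δ p m ∎)
    where
    open ≡-Reasoning
    open +-*-Solver
    swapʳ : ∀ a b c → (a ℕ.+ b) ℕ.+ c ≡ (a ℕ.+ c) ℕ.+ b
    swapʳ = solve 3 (λ a b c → (a :+ b) :+ c := (a :+ c) :+ b) refl

  shift-common-target : ∀ {α p p′ q β γ} →
    Shift α p q β → Shift α p′ q γ → Shift β p′ p γ
  shift-common-target s t m = trans (t m) (sym (s m))

-- Cliques

  -- Going around the triangle `α`, `β`, `γ` cancels all column lengths and leaves an identity
  -- between Kronecker deltas.
  shifts-balance : ∀ {α p q p′ q′ r r′ β γ} →
    Shift α p q β → Shift α p′ q′ γ → Shift β r r′ γ →
    ∀ m → δ q′ m ℕ.+ δ p m ℕ.+ δ r m ≡ δ p′ m ℕ.+ δ q m ℕ.+ δ r′ m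
  shifts-balance {α} {p} {q} {p′} {q′} {r} {r′} {β} {γ} s t u m =
    combine (column α m) (column β m) (column γ m)
      (δ p m) (δ q m) (δ p′ m) (δ q′ m) (δ r m) (δ r′ m) (s m) (t m) (u m)
    where
    open ≡-Reasoning
    open +-*-Solver
    combine : ∀ a b c x y x′ y′ z z′ → b ℕ.+ x ≡ a ℕ.+ y → c ℕ.+ x′ ≡ a ℕ.+ y′ →
      c ℕ.+ z ≡ b ℕ.+ z′ → y′ ℕ.+ x ℕ.+ z ≡ x′ ℕ.+ y ℕ.+ z′
    combine a b c x y x′ y′ z z′ s t u = ℕ.+-cancelˡ-≡ a _ _ (begin
      a ℕ.+ (y′ ℕ.+ x ℕ.+ z)
        ≡⟨ solve 4 (λ a y′ x z → a :+ (y′ :+ x :+ z) := (a :+ y′) :+ (x :+ z)) refl a y′ x z ⟩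
      (a ℕ.+ y′) ℕ.+ (x ℕ.+ z)
        ≡⟨ cong (ℕ._+ (x ℕ.+ z)) (sym t) ⟩
      (c ℕ.+ x′) ℕ.+ (x ℕ.+ z)
        ≡⟨ solve 4 (λ c x′ x z → (c :+ x′) :+ (x :+ z) := (c :+ z) :+ (x :+ x′)) refl c x′ x z ⟩
      (c ℕ.+ z) ℕ.+ (x ℕ.+ x′)
        ≡⟨ cong (ℕ._+ (x ℕ.+ x′)) u ⟩
      (b ℕ.+ z′) ℕ.+ (x ℕ.+ x′)
        ≡⟨ solve 4 (λ b z′ x x′ → (b :+ z′) :+ (x :+ x′) := (b :+ x) :+ (x′ :+ z′)) refl b z′ x x′ ⟩
      (b ℕ.+ x) ℕ.+ (x′ ℕ.+ z′)
        ≡⟨ cong (ℕ._+ (x′ ℕ.+ z′)) s ⟩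
      (a ℕ.+ y) ℕ.+ (x′ ℕ.+ z′)
        ≡⟨ solve 4 (λ a y x′ z′ → (a :+ y) :+ (x′ :+ z′) := a :+ (x′ :+ y :+ z′)) refl a y x′ z′ ⟩
      a ℕ.+ (x′ ℕ.+ y ℕ.+ z′) ∎)

  -- Suppose both columns differ. In the balance, the left side is positive at `p` and at `q′`, and
  -- on the right only `r′` can account for this. So p = r′ = q′, and there the left side is at
  -- least 2 while the right side is 1.
  shifts-share : ∀ {α p q p′ q′ r r′ β γ} → p ≢ q → p′ ≢ q′ →
    Shift α p q β → Shift α p′ q′ γ → Shift β r r′ γ → p ≡ p′ ⊎ q ≡ q′
  shifts-share {α} {p} {q} {p′} {q′} {r} {r′} {β} {γ} p≢q p′≢q′ s t u
    with p ℕ.≟ p′ | q ℕ.≟ q′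
  ... | yes e | _     = inj₁ e
  ... | no _  | yes e = inj₂ e
  ... | no p≢p′ | no q≢q′ = ⊥-elim (contra r′≡p r′≡q′)
    where
    balance = shifts-balance {α} {p} {q} {p′} {q′} {r} {r′} {β} {γ} s t u

    r′≡p : r′ ≡ p
    r′≡p with r′ ℕ.≟ p
    ... | yes e = e
    ... | no ne with balance p
    ...   | e rewrite δ-self p | δ-other (p≢p′ ∘ sym) | δ-other (p≢q ∘ sym) | δ-other ne
                    | ℕ.+-comm (δ q′ p) 1 with e
    ...     | ()

    r′≡q′ : r′ ≡ q′
    r′≡q′ with r′ ℕ.≟ q′
    ... | yes e = e
    ... | no ne with balance q′
    ...   | e rewrite δ-self q′ | δ-other p′≢q′ | δ-other q≢q′ | δ-other ne with e
    ...     | ()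

    contra : r′ ≡ p → r′ ≡ q′ → ⊥
    contra refl refl with balance r′
    ... | e rewrite δ-self r′ | δ-other (p≢p′ ∘ sym) | δ-other (p≢q ∘ sym) with e
    ...   | ()

  Clique : List (Partition n) → Set
  Clique σ = ∀ u v → u ∈ σ → v ∈ σ → u ≢ v → Adjacent u v

  clique⇒shift : ∀ {σ u v} → Clique σ → u ∈ σ → v ∈ σ → ∃[ p ] ∃[ q ] Shift u p q v
  clique⇒shift {u = u} {v} clique u∈ v∈ with u ≟ᵖ v
  -- Equal vertices are joined by a trivial shift; its column is arbitrary.
  ... | yes refl = 0 , 0 , λ _ → refl
  ... | no  u≢v  = adjacent⇒shift {u} {v} (clique u v u∈ v∈ u≢v)

  -- Seen from α, two members of a clique share the source or the target
  -- column.  If not all share the source p of β, then one with another source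
  -- forces the target q of β on all of them.
  shifts-in-clique : ∀ {σ α β p q} → Clique σ → α ∈ σ → β ∈ σ → β ≢ α → Shift α p q β →
    All (λ γ → ∃[ q′ ] Shift α p q′ γ) σ ⊎ All (λ γ → ∃[ p′ ] Shift α p′ q γ) σ
  shifts-in-clique {σ} {α} {β} {p} {q} clique α∈ β∈ β≢α s =
    [ inj₁ , inj₂ ∘ common-target ∘ find ]′
      (allOrAny (All.tabulate classify))
    where
    p≢q : p ≢ q
    p≢q = shift-proper {α} {p} {q} {β} s β≢α

    Source Other : Partition n → Set
    Source γ = ∃[ q′ ] Shift α p q′ γ
    Other  γ = ∃[ p′ ] p′ ≢ p × p′ ≢ q × Shift α p′ q γ

    classify : ∀ {γ} → γ ∈ σ → Source γ ⊎ Other γ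
    classify {γ} γ∈ with γ ≟ᵖ α
    ... | yes refl = inj₁ (p , λ _ → refl)
    ... | no  γ≢α with clique⇒shift clique α∈ γ∈ | clique⇒shift clique β∈ γ∈
    ...   | p′ , q′ , t | r , r′ , u with p′ ℕ.≟ p
    ...     | yes refl = inj₁ (q′ , t)
    ...     | no p′≢p with shift-proper {α} {p′} {q′} {γ} t γ≢α
    ...       | p′≢q′ with shifts-share {α} {p} {q} {p′} {q′} {r} {r′} {β} {γ} p≢q p′≢q′ s t u
    ...         | inj₁ e    = ⊥-elim (p′≢p (sym e))
    ...         | inj₂ refl = inj₂ (p′ , p′≢p , p′≢q′ , t)

    common-target : ∃[ ω ] ω ∈ σ × Other ω → All (λ γ → ∃[ p′ ] Shift α p′ q γ) σ
    common-target (ω , ω∈ , p₁ , p₁≢p , p₁≢q , s₁) = All.tabulate target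
      where
      target : ∀ {γ} → γ ∈ σ → ∃[ p′ ] Shift α p′ q γ
      target {γ} γ∈ with classify γ∈
      ... | inj₂ (p′ , _ , _ , t) = p′ , t
      ... | inj₁ (q′ , t) with γ ≟ᵖ α
      ...   | yes refl = q , λ _ → refl
      ...   | no γ≢α with clique⇒shift clique ω∈ γ∈
      ...     | r , r′ , u with shifts-share {α} {p₁} {q} {p} {q′} {r} {r′} {ω} {γ} p₁≢q
                                  (shift-proper {α} {p} {q′} {γ} t γ≢α) s₁ t u
      ...       | inj₁ e    = ⊥-elim (p₁≢p e)
      ...       | inj₂ refl = p , t

  -- The last nonempty row ends in a removable corner, and the length of column 0 locates it. An
  -- empty column 0 would mean that there are no rows at all, contradicting `n ≥ 1`.
  exists-removable : n ≥ 1 → (α : Partition n) → ∃[ c ] Removable α c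
  exists-removable n≥1 α with column α 0 in e
  ... | suc c = c , last-row-removable {α} {0} e
  ... | zero with parts α | positive α | total α
  ...   | []        | _     | refl with n≥1
  ...     | ()
  exists-removable n≥1 α | zero | zero ∷ _  | () ∷ _ | _
  exists-removable n≥1 α | zero | suc x ∷ _ | _ | _ with e
  ...   | ()

  -- A vertex `β ≢ α` fixes columns `p` and `q`; by `shifts-in-clique` one of them is common to the
  -- whole clique, and it is turned back into a corner of `α`.
  clique-covered : n ≥ 1 → ∀ {σ} → σ ≢ [] → Clique σ →
    (∃[ α ] ∃[ c ] Removable α c × All (StarVertex α c) σ) ⊎
    (∃[ α ] ∃[ a ] Addable   α a × All (TopVertex  α a) σ)
  clique-covered n≥1 {[]}    ne _ = ⊥-elim (ne refl)
  clique-covered n≥1 {α ∷ σ} _ clique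
    with All.decide (λ β → toSum (β ≟ᵖ α)) (α ∷ σ)
  -- With `α` as the only vertex no shift singles out a corner, so any removable one serves.
  ... | inj₁ all≡α with exists-removable n≥1 α
  ...   | c , rem = inj₁ (α , c , rem , All.map inj₁ all≡α)
  clique-covered n≥1 {α ∷ σ} _ clique | inj₂ any≢α with find any≢α
  ... | β , β∈ , β≢α with clique⇒shift clique (here refl) β∈
  ...   | p , q , s with shift-proper {α} {p} {q} {β} s β≢α
                       | shifts-in-clique {α ∷ σ} {α} {β} {p} {q} clique (here refl) β∈ β≢α s
  ...     | p≢q | inj₁ sources with shift⇒removable {α} {p} {q} {β} s p≢q
  ...       | c , rem , refl =
    inj₁ (α , c , rem , All.map (λ {γ} (q′ , t) → shift⇒star {α} {c} {q′} {γ} rem t) sources)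
  clique-covered n≥1 {α ∷ σ} _ clique | inj₂ any≢α | β , β∈ , β≢α | p , q , s
    | p≢q | inj₂ targets with shift⇒addable {α} {p} {q} {β} s p≢q
  ...       | a , add , refl =
    inj₂ (α , a , add , All.map (λ {γ} (p′ , t) → shift⇒top {α} {a} {p′} {γ} add t) targets)

  star-clique : ∀ {α c σ} → Removable α c → All (StarVertex α c) σ → Clique σ
  star-clique {α} {c} rem all u v u∈ v∈ u≢v
    with star⇒shift {α} {c} {u} rem (All.lookup all u∈)
       | star⇒shift {α} {c} {v} rem (All.lookup all v∈)
  ... | q , s | q′ , t = shift⇒adjacent {u} {q} {q′} {v}
    (shift-common-source {α} {pred (row α c)} {q} {q′} {u} {v} s t) u≢v

  top-clique : ∀ {α a σ} → Addable α a → All (TopVertex α a) σ → Clique σ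
  top-clique {α} {a} add all u v u∈ v∈ u≢v
    with top⇒shift {α} {a} {u} add (All.lookup all u∈)
       | top⇒shift {α} {a} {v} add (All.lookup all v∈)
  ... | p , s | p′ , t = shift⇒adjacent {u} {p′} {p} {v}
    (shift-common-target {α} {p} {p′} {row α a} {u} {v} s t) u≢v

-- Full simplices and their intersections

module _ {V : Set} where

  -- Every vertex is a cone apex. The condition passes to intersections directly, so the vertices of
  -- an intersection need not be described.
  Joinable : Complex V → Set
  Joinable X = ∀ {v σ} → Simplex X (v ∷ []) → Simplex X σ → Simplex X (v ∷ σ)

  fullSimplex-joinable : ∀ {X} {S : V → Set} → X ≐ fullSimplex S → Joinable X
  fullSimplex-joinable X≐ {v} {σ} sv sσ with Equivalence.to (X≐ (v ∷ [])) sv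
  ... | _ , v∈S ∷ [] = Equivalence.from (X≐ (v ∷ σ))
    ((λ ()) , v∈S ∷ proj₂ (Equivalence.to (X≐ σ) sσ))

  ⋂-joinable : ∀ {k} (X : Fin (suc k) → Complex V) → (∀ i → Joinable (X i)) → Joinable (⋂ X)
  ⋂-joinable X join sv sσ i = join i (sv i) (sσ i)

  -- The first vertex of the given simplex serves as the apex of the cone.
  joinable-contractible : DecidableEquality V → ∀ {X : Complex V} → Joinable X →
                          ∃[ σ ] Simplex X σ → Contractible X
  joinable-contractible _≟_ {X} join ([] , s) = ⊥-elim (nonempty X s refl)
  joinable-contractible _≟_ {X} join (v ∷ σ , s) = cone-contractible _≟_ v apex (join apex)
    where
    apex : Simplex X (v ∷ [])
    apex = down X s (λ ()) λ { (here refl) → here refl }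

-- The star- and top-simplices as a good cover.

member-joinable : ∀ {n U} → 𝒞 n U → Joinable U
member-joinable {n} {U} (star α c _ U≐) = fullSimplex-joinable {X = U} {S = StarVertex α c} U≐
member-joinable {n} {U} (top  α a _ U≐) = fullSimplex-joinable {X = U} {S = TopVertex α a} U≐

member-inhabited : ∀ {n U} → 𝒞 n U → ∃[ σ ] Simplex U σ
member-inhabited (star α _ _ U≐) =
  α ∷ [] , Equivalence.from (U≐ (α ∷ [])) ((λ ()) , inj₁ refl ∷ [])
member-inhabited (top  α _ _ U≐) =
  α ∷ [] , Equivalence.from (U≐ (α ∷ [])) ((λ ()) , inj₁ refl ∷ [])

theorem4p4 : (n : ℕ) → n ≥ 1 → GoodCover (K n) (𝒞 n)
theorem4p4 n n≥1 = record
  { subcomplex    = subcomplex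
  ; covers        = covers
  ; contractible  = λ U U∈ →
      joinable-contractible _≟ᵖ_ (member-joinable U∈) (member-inhabited U∈)
  ; intersections = λ k U U∈ →
      joinable-contractible _≟ᵖ_ (⋂-joinable U λ i → member-joinable (U∈ i))
  }
  where
  subcomplex : ∀ U → 𝒞 n U → U ⊑ K n
  subcomplex U (star α c rem U≐) σ s with Equivalence.to (U≐ σ) s
  ... | ne , all = ne , star-clique rem all
  subcomplex U (top α a add U≐) σ s with Equivalence.to (U≐ σ) s
  ... | ne , all = ne , top-clique add all

  covers : ∀ σ → Simplex (K n) σ → ∃[ U ] 𝒞 n U × Simplex U σ
  covers σ (ne , clique) with clique-covered n≥1 ne clique
  ... | inj₁ (α , c , rem , all) =
    fullSimplex (StarVertex α c) , star α c rem (λ _ → mk⇔ id id) , ne , all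
  ... | inj₂ (α , a , add , all) =
    fullSimplex (TopVertex α a) , top α a add (λ _ → mk⇔ id id) , ne , all
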